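{- Let $G$ be a $k$-regular super-$\lambda''$ graph with $k\geqslant 4$. Let $g(G)$ denote the girth of $G$ (the length of a shortest cycle). Then (i) if $g(G)\geqslant 4$ (and $k\geqslant 4$), then $\rho'(G)=k-1$; (ii) if $g(G)=3$, then $\rho'(G)\geqslant k-3$ when $k\geqslant 6$, and $\rho'(G)=2$ when $k=5$.
   Context: All graphs are finite and simple. For a connected graph $G=(V,E)$ and an integer $h\geqslant 0$, a set $F\subseteq E(G)$ is an $h$-extra edge-cut if $G-F$ is disconnected and every component of $G-F$ has more than $h$ vertices. If such a set exists, $\lambda^{(h)}(G)$ is the minimum cardinality of an $h$-extra edge-cut, and $G$ is called $\lambda^{(h)}$-connected. A $\lambda^{(h)}$-cut is an $h$-extra edge-cut of cardinality $\lambda^{(h)}(G)$. Write $\lambda'=\lambda^{(1)}$ and $\lambda''=\lambda^{(2)}$. For $X\subset V(G)$, $d_G(X)$ is the number of edges between $X$ and $V(G)\setminus X$, and $\xi_h(G)=\min\{d_G(X): X\subset V(G),\ |X|=h+1,\ G[X]\text{ connected}\}$. A $\lambda^{(h)}$-connected graph $G$ is $\lambda^{(h)}$-optimal if $\lambda^{(h)}(G)=\xi_h(G)$, and it is super-$\lambda^{(h)}$ if it is $\lambda^{(h)}$-optimal and, for every $\lambda^{(h)}$-cut $F$ of $G$, some component of $G-F$ has exactly $h+1$ vertices. Super-$\lambda'$ and super-$\lambda''$ are the cases $h=1$ and $h=2$. A disconnected graph is not super-$\lambda^{(h)}$. For a super-$\lambda'$ graph $G$, the persistence $\rho'(G)$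 is the maximum integer $m$ such that $G-F$ is still super-$\lambda'$ for every $F\subseteq E(G)$ with $|F|\leqslant m$. Any assertion about $\rho'(G)$ includes the assertion that $G$ is super-$\lambda'$. -}

module Defs where

open import Algebra.Properties.CommutativeMonoid.Sum using (sum)
open import Data.Bool.Base using (Bool; false; _∧_; not; T; if_then_else_)
open import Data.Fin.Base using (Fin; toℕ)
open import Data.Fin.Subset using (Subset; _∈_; ∣_∣; Nonempty)
open import Data.Nat.Base using (ℕ; suc; _≤_; _<_; _<ᵇ_)
open import Data.Nat.Properties using (+-0-commutativeMonoid)
open import Data.Product.Base using (_×_; Σ; ∃-syntax)
open import Data.Vec.Base using (lookup)
open import Function.Bundles using (_⇔_)
open import Function.Definitions using (Injective)
open import Relation.Binary.Construct.Closure.ReflexiveTransitive using (Star)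
open import Relation.Binary.PropositionalEquality using (_≡_; cong; cong₂)
open import Relation.Nullary.Negation.Core using (¬_)

IsMinimum : (ℕ → Set) → ℕ → Set
IsMinimum P m = P m × (∀ j → P j → m ≤ j)

IsMaximum : (ℕ → Set) → ℕ → Set
IsMaximum P m = P m × (∀ j → P j → j ≤ m)

#[_] : ∀ {n} → (Fin n → Bool) → ℕ
#[ p ] = sum +-0-commutativeMonoid (λ i → if p i then 1 else 0)

#₂[_] : ∀ {n} → (Fin n → Fin n → Bool) → ℕ
#₂[ p ] = sum +-0-commutativeMonoid (λ i → #[ p i ])

record Graph (n : ℕ) : Set where
  field
    adj     : Fin n → Fin n → Bool
    adj-sym : ∀ u v → adj u v ≡ adj v u
    adj-irr : ∀ v → adj v v ≡ false

open Graph public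

Adj : ∀ {n} → Graph n → Fin n → Fin n → Set
Adj G u v = T (adj G u v)

-- A set of unordered pairs of distinct vertices is the same thing as a simple
-- graph on those vertices, so edge sets are again of type Graph n.
EdgeSet : ℕ → Set
EdgeSet = Graph

_⊆E_ : ∀ {n} → EdgeSet n → Graph n → Set
F ⊆E G = ∀ u v → Adj F u v → Adj G u v

-- Each edge is counted once, from its smaller endpoint.
size : ∀ {n} → EdgeSet n → ℕ
size F = #₂[ (λ u v → (toℕ u <ᵇ toℕ v) ∧ adj F u v) ]

_∖_ : ∀ {n} → Graph n → EdgeSet n → Graph n
adj     (G ∖ F) u v = adj G u v ∧ not (adj F u v)
adj-sym (G ∖ F) u v = cong₂ (λ a b → a ∧ not b) (adj-sym G u v) (adj-sym F u v)
adj-irr (G ∖ F) v   = cong (_∧ not (adj F v v)) (adj-irr G v)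

Regular : ∀ {n} → Graph n → ℕ → Set
Regular G k = ∀ v → #[ adj G v ] ≡ k

Connected : ∀ {n} → Graph n → Set
Connected G = ∀ u v → Star (Adj G) u v

InducedConnected : ∀ {n} → Graph n → Subset n → Set
InducedConnected G X =
  ∀ u v → u ∈ X → v ∈ X → Star (λ a b → a ∈ X × b ∈ X × Adj G a b) u v

IsComponent : ∀ {n} → Graph n → Subset n → Set
IsComponent G C = Nonempty C × (∀ u → u ∈ C → ∀ v → (v ∈ C ⇔ Star (Adj G) u v))

IsExtraEdgeCut : ∀ {n} → ℕ → Graph n → EdgeSet n → Set
IsExtraEdgeCut h G F =
  F ⊆E G × ¬ Connected (G ∖ F) × (∀ C → IsComponent (G ∖ F) C → h < ∣ C ∣)

-- Isλ h G m says that G is λ⁽ʰ⁾-connected and λ⁽ʰ⁾(G) = m.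
Isλ : ∀ {n} → ℕ → Graph n → ℕ → Set
Isλ h G = IsMinimum (λ m → ∃[ F ] IsExtraEdgeCut h G F × size F ≡ m)

IsλCut : ∀ {n} → ℕ → Graph n → EdgeSet n → Set
IsλCut h G F = IsExtraEdgeCut h G F × Isλ h G (size F)

boundary : ∀ {n} → Graph n → Subset n → ℕ
boundary G X = #₂[ (λ u v → lookup X u ∧ not (lookup X v) ∧ adj G u v) ]

-- Properness of X need not be imposed: a λ⁽ʰ⁾-connected graph has at least
-- 2(h + 1) vertices.
Isξ : ∀ {n} → ℕ → Graph n → ℕ → Set
Isξ {n} h G = IsMinimum λ m →
  Σ (Subset n) λ X → ∣ X ∣ ≡ suc h × InducedConnected G X × boundary G X ≡ m

IsλOptimal : ∀ {n} → ℕ → Graph n → Set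
IsλOptimal h G = ∃[ m ] Isλ h G m × Isξ h G m

IsSuperλ : ∀ {n} → ℕ → Graph n → Set
IsSuperλ h G =
    Connected G
  × IsλOptimal h G
  × (∀ F → IsλCut h G F → ∃[ C ] IsComponent (G ∖ F) C × ∣ C ∣ ≡ suc h)

-- IsPersistence G m says that G is super-λ′ and ρ′(G) = m.
IsPersistence : ∀ {n} → Graph n → ℕ → Set
IsPersistence G m =
    IsSuperλ 1 G
  × IsMaximum (λ j → ∀ F → F ⊆E G → size F ≤ j → IsSuperλ 1 (G ∖ F)) m

record Cycle {n : ℕ} (G : Graph n) (l : ℕ) : Set where
  field
    length≥3  : 3 ≤ l
    vertex    : Fin l → Fin n
    injective : Injective _≡_ _≡_ vertex
    step      : ∀ i j → toℕ j ≡ suc (toℕ i) → Adj G (vertex i) (vertex j)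
    close     : ∀ i j → suc (toℕ i) ≡ l → toℕ j ≡ 0 → Adj G (vertex i) (vertex j)

IsGirth : ∀ {n} → Graph n → ℕ → Set
IsGirth G = IsMinimum (Cycle G)

{-# OPTIONS --safe #-}
module Submission where

-- Let H = G ∖ F with F small.  If all components left by a 1-extra edge-cut F′ of
-- H have at least three vertices, then F ∪ F′ is a 2-extra edge-cut of G, whence
-- |F| + |F′| ≥ λ″(G) = ξ₂(G), and in case of equality some component has exactly
-- three vertices.  Either way an edge of H has boundary less than |F′|.  So H is
-- super-λ′ if and only if every 2-extra edge-cut of H is larger than the boundary
-- of some edge; as |F| < k, the cut around an edge of minimum boundary is itself a
-- 1-extra edge-cut of H.  This criterion is decidable, so ρ′ exists.  Removing
-- the star of a vertex gives ρ′ < k, and for k = 5 a matching leaving a triangle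
-- shows that three edges are already too many.

-- Write Λ for λ″(G) and m for the number of edges whose loss is to be harmless. A triple spanning t
-- edges has boundary 3k - 2t, so Λ is at least 3k - 4 without triangles and at least 3k - 6 in
-- general. With m = k - 1 and m = k - 3 respectively, both bounds read Λ ≥ 2k + m - 3, which is
-- where the two values come from. If |F| + |F′| > Λ, this gives |F′| ≥ 2k - 2, already the largest
-- boundary that an edge of H can have; strictness comes from an edge at an end of a removed edge
-- or, if F is empty, from m ≥ 1. If |F| + |F′| = Λ, one vertex is dropped from the three-vertex
-- component. This lowers the boundary by its degree minus 2 at the end of a path, and by its degree
-- minus 4 in a triangle, so a vertex of degree at least 3, respectively 5, must have survived the
-- removal of F. Constructively, the persistence in (ii) has to be found by search, whereas super-λ′
-- speaks of paths and of minima over all cuts; hence the reformulation by closed sets and single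
-- edges.

open import Defs
open import Data.Empty using (⊥; ⊥-elim)
open import Data.List.Base using (List; []; _∷_; map; length; filter; allFin)
open import Data.Nat.Base using (ℕ; zero; suc; _+_; _*_; _∸_; _≤_; _<_; _<ᵇ_; z≤n; s≤s)
open import Data.Nat.Properties using (<ᵇ⇒<; <⇒<ᵇ; ≤-reflexive; ≤-refl; ≤-antisym; ≤-trans; _≤?_; ≤-pred; n≤1+n; <⇒≤; <⇒≱; ≰⇒>; ≮⇒≥; ≤∧≢⇒<; <-irrefl; <-cmp; _<?_; n≮0; m≤n⇒m<n∨m≡n; +-suc; +-identityʳ; +-comm; +-cancelʳ-≡; +-0-commutativeMonoid; +-cancelʳ-≤; +-cancelʳ-<; m≤m+n; m≤n+m; +-mono-≤; +-monoˡ-≤; +-monoʳ-≤; *-cancelˡ-≡; *-cancelˡ-≤; *-monoʳ-≤; m∸n+n≡m) renaming (_≟_ to _≟ℕ_)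
open import Data.Nat.Tactic.RingSolver using (solve-∀; solve)
open import Data.Sum.Base using (_⊎_; inj₁; inj₂; [_,_]′)
open import Relation.Binary.PropositionalEquality using (_≡_; _≢_; refl; sym; trans; cong; cong₂; subst; module ≡-Reasoning)
open import Relation.Nullary using (¬_; Dec; yes; no; does; contradiction)

-- Arithmetic of degrees, boundaries and cut sizes

-- Linear arithmetic by certificate: L ≤ R is the sum of the hypotheses, and c
-- is what remains to be cancelled from it.
linear : ∀ {a b L R} c → L ≤ R → a + c ≡ L → R ≡ b + c → a ≤ b
linear {a} {b} c L≤R p q = +-cancelʳ-≤ c a b (≤-trans (≤-reflexive p) (≤-trans L≤R (≤-reflexive q)))

infixl 6 _⊕_
_⊕_ : ∀ {a b c d} → a ≤ b → c ≤ d → a + c ≤ b + d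
_⊕_ = +-mono-≤

-- `ha`, `hb` stand for degrees in H and `fa`, `fb` for degrees in the removed set F. `B` is the
-- boundary of the pair in F, `z` twice the number of edges of F inside the pair, and `S` is |F|.
degree-sum₂ : ∀ {k ha hb fa fb B S z} → ha + fa ≡ k → hb + fb ≡ k → B + z ≡ fa + fb → B ≤ S →
              k + k ≤ ha + hb + (S + z)
degree-sum₂ {k} {ha} {hb} {fa} {fb} {B} {S} {z} p q r B≤S = linear (fa + fb + B)
  (≤-reflexive (sym p) ⊕ ≤-reflexive (sym q) ⊕ ≤-reflexive (sym r) ⊕ B≤S)
  (solve (k ∷ fa ∷ fb ∷ B ∷ [])) (solve (ha ∷ hb ∷ fa ∷ fb ∷ B ∷ S ∷ z ∷ []))

degree-sum₃ : ∀ {k ha hb hc fa fb fc B S z} → ha + fa ≡ k → hb + fb ≡ k → hc + fc ≡ k →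
              B + 2 * z ≡ fa + fb + fc → z ≡ 0 → B ≤ S → k + k + k ≤ ha + hb + hc + S
degree-sum₃ {k} {ha} {hb} {hc} {fa} {fb} {fc} {B} {S} p q r t refl B≤S = linear (fa + fb + fc + B)
  (≤-reflexive (sym p) ⊕ ≤-reflexive (sym q) ⊕ ≤-reflexive (sym r) ⊕ ≤-reflexive (sym t) ⊕ B≤S)
  (solve (k ∷ fa ∷ fb ∷ fc ∷ B ∷ []))
  (solve (ha ∷ hb ∷ hc ∷ fa ∷ fb ∷ fc ∷ B ∷ S ∷ []))

-- Two vertices of G have boundary at least 2k - 2, which is more than |F|.
small-pair-absurd : ∀ {k B z S} → B + z ≡ k + k → B ≤ S → z ≤ 2 → S < k → ¬ 4 ≤ k
small-pair-absurd {k} {B} {z} {S} p B≤S z≤2 S<k 4≤k = n≮0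
  (linear {3} {0} (k + k + B + z + S + 2)
    (≤-reflexive (sym p) ⊕ B≤S ⊕ z≤2 ⊕ S<k ⊕ 4≤k)
    (solve (k ∷ B ∷ z ∷ S ∷ [])) (solve (k ∷ B ∷ z ∷ S ∷ [])))

-- The hypotheses give 2k ≤ 4 + |F| ≤ k + 3, which is just what 4 ≤ k excludes.
low-degrees-absurd : ∀ {k S d₁ d₂ z} → S < k → 4 ≤ k → k + k ≤ d₁ + d₂ + (S + z) → ¬ (d₁ + d₂ + z ≤ 4)
low-degrees-absurd {k} {S} {d₁} {d₂} {z} S<k 4≤k p q = n≮0
  (linear {1} {0} (4 + k + k + d₁ + d₂ + S + z) (S<k ⊕ 4≤k ⊕ p ⊕ q)
    (solve (S ∷ k ∷ d₁ ∷ d₂ ∷ z ∷ [])) (solve (S ∷ k ∷ d₁ ∷ d₂ ∷ z ∷ [])))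

compare-degrees : ∀ {B B₁ du dv dw} → B + 2 ≡ du + dv → B₁ + 2 ≡ dw + du → B ≤ B₁ → dv ≤ dw
compare-degrees {B} {B₁} {du} {dv} {dw} p q r = linear (du + B + 2 + B₁)
  (≤-reflexive (sym p) ⊕ ≤-reflexive q ⊕ r)
  (solve (B ∷ B₁ ∷ du ∷ dv ∷ [])) (solve (B ∷ B₁ ∷ du ∷ dw ∷ []))

path-degrees : ∀ {k S z da dc} → k + k ≤ da + dc + (S + z) → S + z < k → 4 ≤ k → 3 ≤ da ⊎ 3 ≤ dc
path-degrees {k} {S} {z} {da} {dc} p q 4≤k with 3 ≤? da | 3 ≤? dc
... | yes a | _     = inj₁ a
... | no _  | yes c = inj₂ c
... | no ¬a | no ¬c = ⊥-elim (n≮0 (linear {1} {0} (da + dc + S + z + k + k + 4)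
  (p ⊕ q ⊕ 4≤k ⊕ ≤-pred (≰⇒> ¬a) ⊕ ≤-pred (≰⇒> ¬c))
  (solve (k ∷ S ∷ z ∷ da ∷ dc ∷ [])) (solve (k ∷ S ∷ z ∷ da ∷ dc ∷ []))))

-- The degrees add up to at least 3k - m = 2k + 3 ≥ 13, so they cannot all be at most 4.
triangle-degrees : ∀ {k m S da db dc} → k + k + k ≤ da + db + dc + S → S ≤ m → m + 3 ≡ k → 5 ≤ k →
                   5 ≤ da ⊎ 5 ≤ db ⊎ 5 ≤ dc
triangle-degrees {_} {m} {S} {da} {db} {dc} p q refl 5≤k with 5 ≤? da | 5 ≤? db | 5 ≤? dc
... | yes a | _     | _     = inj₁ a
... | no _  | yes b | _     = inj₂ (inj₁ b)
... | no _  | no _  | yes c = inj₂ (inj₂ c)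
... | no ¬a | no ¬b | no ¬c = ⊥-elim (n≮0 (linear {1} {0} (da + db + dc + S + m + m + m + 18)
  (p ⊕ q ⊕ 5≤k ⊕ 5≤k ⊕ ≤-pred (≰⇒> ¬a) ⊕ ≤-pred (≰⇒> ¬b) ⊕ ≤-pred (≰⇒> ¬c))
  (solve (m ∷ S ∷ da ∷ db ∷ dc ∷ [])) (solve (m ∷ S ∷ da ∷ db ∷ dc ∷ []))))

-- The end c of the path has one edge to the pair ab and `dc` - 1 edges elsewhere, so adding it to
-- the pair changes the boundary by `dc` - 2.
path-edge : ∀ {B C da db dc} → B + 2 ≡ da + db → C + 2 * 2 ≡ da + db + dc → 3 ≤ dc → B < C
path-edge {B} {C} {da} {db} {dc} p q r = linear (da + db + dc + 4)
  (≤-reflexive p ⊕ ≤-reflexive (sym q) ⊕ r)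
  (solve (B ∷ da ∷ db ∷ dc ∷ [])) (solve (C ∷ da ∷ db ∷ dc ∷ []))

-- Now c has two edges to the pair, and the change is `dc` - 4.
triangle-edge : ∀ {B C da db dc} → B + 2 ≡ da + db → C + 2 * 3 ≡ da + db + dc → 5 ≤ dc → B < C
triangle-edge {B} {C} {da} {db} {dc} p q r = linear (da + db + dc + 6)
  (≤-reflexive p ⊕ ≤-reflexive (sym q) ⊕ r)
  (solve (B ∷ da ∷ db ∷ dc ∷ [])) (solve (C ∷ da ∷ db ∷ dc ∷ []))

-- `S′` is at least 2k - 2, whereas x has lost an edge, so that the edge xz has boundary at most (k
-- - 1) + k - 2.
damaged-edge : ∀ {k m Λ S S′ B dx fx dz} → B + 2 ≡ dx + dz → dx + fx ≡ k → 1 ≤ fx → dz ≤ k →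
               Λ < S + S′ → S ≤ m → k + k + m ≤ Λ + 3 → B < S′
damaged-edge {_} {m} {Λ} {S} {S′} {B} {dx} {fx} {dz} p refl 1≤fx dz≤k q S≤m r =
  linear (dx + fx + dx + fx + dz + Λ + S + m + 3)
    (≤-reflexive p ⊕ 1≤fx ⊕ dz≤k ⊕ q ⊕ S≤m ⊕ r)
    (solve (m ∷ Λ ∷ S ∷ B ∷ dx ∷ fx ∷ dz ∷ []))
    (solve (m ∷ Λ ∷ S ∷ S′ ∷ dx ∷ fx ∷ dz ∷ []))

-- With nothing removed, an edge may have boundary 2k - 2, but `S′` exceeds `Λ` itself and 1 ≤ `m`
-- makes it at least 2k - 1.
undamaged-edge : ∀ {k m Λ S S′ B dx dz} → B + 2 ≡ dx + dz → dx ≤ k → dz ≤ k →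
                 Λ < S + S′ → S ≡ 0 → 1 ≤ m → k + k + m ≤ Λ + 3 → B < S′
undamaged-edge {k} {m} {Λ} {_} {S′} {B} {dx} {dz} p dx≤k dz≤k q refl 1≤m r =
  linear (dx + dz + k + k + Λ + m + 3)
    (≤-reflexive p ⊕ dx≤k ⊕ dz≤k ⊕ q ⊕ 1≤m ⊕ r)
    (solve (k ∷ m ∷ Λ ∷ B ∷ dx ∷ dz ∷ []))
    (solve (k ∷ m ∷ Λ ∷ S′ ∷ dx ∷ dz ∷ []))

-- `t` is the number of edges spanned by a triple with boundary `Λ`.
λ″-bound₂ : ∀ {k m Λ t} → Λ + 2 * t ≡ k + k + k → t ≤ 2 → m + 1 ≡ k → k + k + m ≤ Λ + 3
λ″-bound₂ {_} {m} {Λ} {t} p t≤2 refl = linear (2 * t + 1)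
  (≤-reflexive (sym p) ⊕ t≤2 ⊕ t≤2) (solve (m ∷ t ∷ [])) (solve (m ∷ Λ ∷ t ∷ []))

λ″-bound₃ : ∀ {k m Λ t} → Λ + 2 * t ≡ k + k + k → t ≤ 3 → m + 3 ≡ k → k + k + m ≤ Λ + 3
λ″-bound₃ {_} {m} {Λ} {t} p t≤3 refl = linear (2 * t + 3)
  (≤-reflexive (sym p) ⊕ t≤3 ⊕ t≤3) (solve (m ∷ t ∷ [])) (solve (Λ ∷ t ∷ []))

k≤λ″ : ∀ {k m Λ} → k + k + m ≤ Λ + 3 → 4 ≤ k → k ≤ Λ
k≤λ″ {k} {m} {Λ} p 4≤k = ≤-trans (m≤m+n k (m + 1)) (linear (k + 3) (p ⊕ 4≤k)
  (solve (k ∷ m ∷ [])) (solve (k ∷ Λ ∷ [])))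

open import Algebra.Properties.CommutativeMonoid.Sum using (sum; sum-cong-≗; ∑-distrib-+; ∑-comm; sum-replicate-zero)
open import Data.Bool.Base using (Bool; true; false; _∧_; _∨_; not; T; if_then_else_)
open import Data.Bool.Properties using (T?; T-≡; T-∧; T-∨; ∨-comm; ∨-idem; ∧-identityʳ; ∧-zeroʳ)
open import Data.Fin.Base using (Fin; zero; suc; toℕ)
open import Data.Fin.Properties using (_≟_; any?; all?; toℕ-injective)
open import Data.Fin.Subset using (Subset; _∈_; _∉_; _⊆_; ∣_∣; Nonempty; ⁅_⁆; ⋃; _-_; _─_; _∪_)
open import Data.Fin.Subset.Properties using (_∈?_; nonempty?; ∣p∣≤n; ∉⊥; x∈⁅x⁆; x∈⁅y⁆⇒x≡y; ∣⁅x⁆∣≡1; ⊆-antisym; p⊆q⇒∣p∣≤∣q∣; p⊂q⇒∣p∣<∣q∣; x∈p∪q⁻; x∈p∪q⁺; p─q⊆p; x∈p∧x≢y⇒x∈p-y; anySubset?)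
import Data.List.Membership.DecPropositional as DecPropositional
open import Data.List.Membership.Propositional using () renaming (_∈_ to _∈ˡ_; _∉_ to _∉ˡ_)
open import Data.List.Membership.Propositional.Properties using (∈-filter⁺; ∈-filter⁻; ∈-allFin)
open import Data.List.Properties using (map-cong; length-map)
open import Data.List.Relation.Unary.All using (All; []; _∷_) renaming (lookup to lookupAll)
open import Data.List.Relation.Unary.AllPairs using ([]; _∷_)
open import Data.List.Relation.Unary.Any using (here; there)
open import Data.List.Relation.Unary.Unique.Propositional using (Unique)
open import Data.List.Relation.Unary.Unique.Propositional.Properties using (allFin⁺; filter⁺)
open import Data.Nat.ListAction using () renaming (sum to sumˡ)
open import Data.Product.Base using (_×_; _,_; ∃-syntax; proj₁; proj₂)
open import Data.Product.Properties using (≡-dec)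
open import Data.Vec.Base using (Vec; lookup; tabulate; []; _∷_) renaming (there to thereᵛ)
open import Data.Vec.Properties using ([]=⇒lookup; lookup⇒[]=; lookup∘tabulate)
open import Function.Base using (_∘_)
open import Function.Bundles using (mk⇔; module Equivalence)
open import Relation.Binary.Construct.Closure.ReflexiveTransitive using (Star; ε; _◅_; _◅◅_)
open import Relation.Binary.Definitions using (tri<; tri≈; tri>)
open import Relation.Nullary.Decidable using (_×-dec_; _→-dec_; ¬?; dec-true; dec-false; does-⇔; map′; decidable-stable)
open import Relation.Unary using (Decidable)

open Equivalence using (to; from)

-- Finite sums and Boolean indicators

∑ : ∀ {n} → (Fin n → ℕ) → ℕ
∑ = sum +-0-commutativeMonoid

∑-cong : ∀ {n} {f g : Fin n → ℕ} → (∀ i → f i ≡ g i) → ∑ f ≡ ∑ g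
∑-cong = sum-cong-≗ +-0-commutativeMonoid

∑-+ : ∀ {n} (f g : Fin n → ℕ) → ∑ (λ i → f i + g i) ≡ ∑ f + ∑ g
∑-+ = ∑-distrib-+ +-0-commutativeMonoid

∑-swap : ∀ {m n} (f : Fin m → Fin n → ℕ) → ∑ (λ i → ∑ (f i)) ≡ ∑ (λ j → ∑ (λ i → f i j))
∑-swap {m} {n} f = ∑-comm +-0-commutativeMonoid f

∑-0 : ∀ {n} {f : Fin n → ℕ} → (∀ i → f i ≡ 0) → ∑ f ≡ 0
∑-0 {n} f≡0 = trans (∑-cong f≡0) (sum-replicate-zero +-0-commutativeMonoid n)

∑-mono : ∀ {n} {f g : Fin n → ℕ} → (∀ i → f i ≤ g i) → ∑ f ≤ ∑ g
∑-mono {zero}  f≤g = z≤n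
∑-mono {suc n} f≤g = +-mono-≤ (f≤g zero) (∑-mono (f≤g ∘ suc))

ι : Bool → ℕ
ι b = if b then 1 else 0

ι≡0 : ∀ {b} → ¬ T b → ι b ≡ 0
ι≡0 {false} _ = refl
ι≡0 {true}  f = ⊥-elim (f _)

ι≡1 : ∀ {b} → T b → ι b ≡ 1
ι≡1 {true} _ = refl

ι≤1 : ∀ b → ι b ≤ 1
ι≤1 false = z≤n
ι≤1 true  = s≤s z≤n

ι-mono : ∀ {a b} → (T a → T b) → ι a ≤ ι b
ι-mono {false} f = z≤n
ι-mono {true} {b} f = ≤-reflexive (sym (ι≡1 {b} (f _)))

ι-≤ : ∀ {a m} → (T a → 1 ≤ m) → ι a ≤ m
ι-≤ {false} f = z≤n
ι-≤ {true} f = f _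

T-ext : ∀ {a b} → (T a → T b) → (T b → T a) → a ≡ b
T-ext {false} {false} f g = refl
T-ext {false} {true}  f g = ⊥-elim (g _)
T-ext {true}  {false} f g = ⊥-elim (f _)
T-ext {true}  {true}  f g = refl

T-not : ∀ {b} → ¬ T b → T (not b)
T-not {false} _ = _
T-not {true}  f = f _

T-not⁻ : ∀ {b} → T (not b) → ¬ T b
T-not⁻ {false} _ ()

δ : ∀ {n} → Fin n → Fin n → ℕ
δ a u = ι (does (a ≟ u))

∑-if : ∀ {n} (a : Fin n) (f : Fin n → ℕ) → ∑ (λ u → if does (a ≟ u) then f u else 0) ≡ f a
∑-if {suc n} zero f = trans (cong (f zero +_) (∑-0 {n} (λ _ → refl))) (+-identityʳ _)
∑-if (suc a) f = ∑-if a (f ∘ suc)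

∑-δ : ∀ {n} (a : Fin n) → ∑ (δ a) ≡ 1
∑-δ a = ∑-if a (λ _ → 1)

δ-refl : ∀ {n} (a : Fin n) → δ a a ≡ 1
δ-refl a = cong ι (dec-true (a ≟ a) refl)

δ-≢ : ∀ {n} {a u : Fin n} → a ≢ u → δ a u ≡ 0
δ-≢ {_} {a} {u} a≢u = cong ι (dec-false (a ≟ u) a≢u)

_∈ˡ?_ : ∀ {n} (u : Fin n) xs → Dec (u ∈ˡ xs)
_∈ˡ?_ = DecPropositional._∈?_ _≟_

occurrences : ∀ {n} → List (Fin n) → Fin n → ℕ
occurrences xs u = sumˡ (map (λ x → δ x u) xs)

∑-occurrences : ∀ {n} (xs : List (Fin n)) → ∑ (occurrences xs) ≡ length xs
∑-occurrences {n} []       = ∑-0 {n} (λ _ → refl)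
∑-occurrences {n} (x ∷ xs) = trans (∑-+ (δ x) (occurrences xs)) (cong₂ _+_ (∑-δ x) (∑-occurrences xs))

∈⇒occurrences : ∀ {n} {xs : List (Fin n)} {u} → u ∈ˡ xs → 1 ≤ occurrences xs u
∈⇒occurrences {u = u} (here refl) rewrite δ-refl u = s≤s z≤n
∈⇒occurrences {xs = x ∷ _} {u} (there u∈) = ≤-trans (∈⇒occurrences u∈) (m≤n+m _ (δ x u))

∉⇒occurrences : ∀ {n} {xs : List (Fin n)} {u} → All (u ≢_) xs → occurrences xs u ≡ 0
∉⇒occurrences []           = refl
∉⇒occurrences (u≢x ∷ u∉xs) = cong₂ _+_ (δ-≢ (u≢x ∘ sym)) (∉⇒occurrences u∉xs)

unique⇒occurrences : ∀ {n} {xs : List (Fin n)} → Unique xs → ∀ u → occurrences xs u ≤ 1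
unique⇒occurrences [] u = z≤n
unique⇒occurrences {xs = x ∷ xs} (x∉xs ∷ uq) u with x ≟ u
... | yes refl = s≤s (≤-reflexive (∉⇒occurrences x∉xs))
... | no _     = unique⇒occurrences uq u

-- Subsets listed without repetition

module _ {n : ℕ} where

  ∈⇒T : ∀ {u} {X : Subset n} → u ∈ X → T (lookup X u)
  ∈⇒T {u} u∈X = from T-≡ ([]=⇒lookup u∈X)

  T⇒∈ : ∀ {u} {X : Subset n} → T (lookup X u) → u ∈ X
  T⇒∈ {u} {X} t = lookup⇒[]= u X (to T-≡ t)

  ∑∈ : Subset n → (Fin n → ℕ) → ℕ
  ∑∈ X f = ∑ (λ u → if lookup X u then f u else 0)

  -- Only sets of one, two or three vertices need explicit boundaries; a list of their elements
  -- turns a sum over the set into an expression that unfolds by computation.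
  record Enumerates (X : Subset n) (xs : List (Fin n)) : Set where
    constructor enum
    field
      unique : Unique xs
      ∈⇒∈ˡ   : ∀ {u} → u ∈ X → u ∈ˡ xs
      ∈ˡ⇒∈   : ∀ {u} → u ∈ˡ xs → u ∈ X

  open Enumerates public

  elements : ∀ X → ∃[ xs ] Enumerates X xs
  elements X = filter (_∈? X) (allFin n) , record
    { unique = filter⁺ (_∈? X) (allFin⁺ n)
    ; ∈⇒∈ˡ   = λ {u} u∈X → ∈-filter⁺ (_∈? X) (∈-allFin u) u∈X
    ; ∈ˡ⇒∈   = λ u∈xs → proj₂ (∈-filter⁻ (_∈? X) {xs = allFin n} u∈xs)
    }

  ⟦_⟧ : List (Fin n) → Subset n
  ⟦ xs ⟧ = ⋃ (map ⁅_⁆ xs)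

  ∈⟦⟧⁻ : ∀ xs {u} → u ∈ ⟦ xs ⟧ → u ∈ˡ xs
  ∈⟦⟧⁻ []       u∈ = ⊥-elim (∉⊥ u∈)
  ∈⟦⟧⁻ (x ∷ xs) u∈ with x∈p∪q⁻ ⁅ x ⁆ ⟦ xs ⟧ u∈
  ... | inj₁ u∈x  = here (x∈⁅y⁆⇒x≡y x u∈x)
  ... | inj₂ u∈xs = there (∈⟦⟧⁻ xs u∈xs)

  ∈⟦⟧⁺ : ∀ {xs u} → u ∈ˡ xs → u ∈ ⟦ xs ⟧
  ∈⟦⟧⁺ (here {x = x} refl) = x∈p∪q⁺ (inj₁ (x∈⁅x⁆ x))
  ∈⟦⟧⁺ (there u∈xs)        = x∈p∪q⁺ (inj₂ (∈⟦⟧⁺ u∈xs))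

  ⟦⟧-enumerates : ∀ {xs} → Unique xs → Enumerates ⟦ xs ⟧ xs
  ⟦⟧-enumerates {xs} uq = enum uq (∈⟦⟧⁻ xs) ∈⟦⟧⁺

  x∉p-x : ∀ (X : Subset n) a → a ∉ X - a
  x∉p-x X a a∈ = x∉p─q X ⁅ a ⁆ a∈ (x∈⁅x⁆ a)
    where
    x∉p─q : ∀ {m} (p q : Subset m) {x} → x ∈ (p ─ q) → x ∉ q
    x∉p─q (_ ∷ p) (_ ∷ q) (thereᵛ x∈) (thereᵛ x∈q) = x∉p─q p q x∈ x∈q

  enumerates-tail : ∀ {X x xs} → Enumerates X (x ∷ xs) → Enumerates (X - x) xs
  enumerates-tail {X} {x} {xs} E with unique E
  ... | x∉xs ∷ uq = enum uq f g
    where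
    f : ∀ {u} → u ∈ X - x → u ∈ˡ xs
    f {u} u∈ with ∈⇒∈ˡ E (p─q⊆p X ⁅ x ⁆ u∈)
    ... | here refl   = ⊥-elim (x∉p-x X x u∈)
    ... | there u∈xs = u∈xs
    g : ∀ {u} → u ∈ˡ xs → u ∈ X - x
    g u∈xs = x∈p∧x≢y⇒x∈p-y (∈ˡ⇒∈ E (there u∈xs)) (λ { refl → lookupAll x∉xs u∈xs refl })

  ∑∈-remove : ∀ {X : Subset n} {a} f → a ∈ X → ∑∈ X f ≡ f a + ∑∈ (X - a) f
  ∑∈-remove {X} {a} f a∈X = begin
    ∑∈ X f
      ≡⟨ ∑-cong pointwise ⟩
    ∑ (λ u → (if does (a ≟ u) then f u else 0) + (if lookup (X - a) u then f u else 0))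
      ≡⟨ ∑-+ {n} _ _ ⟩
    ∑ (λ u → if does (a ≟ u) then f u else 0) + ∑∈ (X - a) f
      ≡⟨ cong (_+ ∑∈ (X - a) f) (∑-if a f) ⟩
    f a + ∑∈ (X - a) f ∎
    where
    open ≡-Reasoning
    pointwise : ∀ u → (if lookup X u then f u else 0)
      ≡ (if does (a ≟ u) then f u else 0) + (if lookup (X - a) u then f u else 0)
    pointwise u with a ≟ u
    ... | yes refl rewrite to T-≡ (∈⇒T a∈X)
                         | T-ext {lookup (X - a) a} {false} (λ t → x∉p-x X a (T⇒∈ t)) ⊥-elim
                         = sym (+-identityʳ _)
    ... | no a≢u rewrite T-ext {lookup (X - a) u} {lookup X u}
                            (λ t → ∈⇒T (p─q⊆p X ⁅ a ⁆ (T⇒∈ {X = X - a} t)))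
                            (λ t → ∈⇒T (x∈p∧x≢y⇒x∈p-y {p = X} (T⇒∈ t) (a≢u ∘ sym))) = refl

  ∑∈-enum : ∀ {X xs} → Enumerates X xs → ∀ f → ∑∈ X f ≡ sumˡ (map f xs)
  ∑∈-enum {X} {[]} E f = ∑-0 λ u → cong (λ b → if b then f u else 0)
    (T-ext {lookup X u} {false} (λ t → empty (∈⇒∈ˡ E (T⇒∈ t))) ⊥-elim)
    where
    empty : ∀ {u} → ¬ (u ∈ˡ [])
    empty ()
  ∑∈-enum {X} {x ∷ xs} E f = trans (∑∈-remove f (∈ˡ⇒∈ E (here refl)))
    (cong (f x +_) (∑∈-enum (enumerates-tail E) f))

∣p∣≡∑ : ∀ {n} (X : Subset n) → ∣ X ∣ ≡ ∑∈ X (λ _ → 1)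
∣p∣≡∑ []          = refl
∣p∣≡∑ (true ∷ X)  = cong suc (∣p∣≡∑ X)
∣p∣≡∑ (false ∷ X) = ∣p∣≡∑ X

∣p∣≡length : ∀ {n} {X : Subset n} {xs} → Enumerates X xs → ∣ X ∣ ≡ length xs
∣p∣≡length {X = X} {xs} E = trans (∣p∣≡∑ X) (trans (∑∈-enum E (λ _ → 1)) (sum-1 xs))
  where
  sum-1 : ∀ ys → sumˡ (map (λ _ → 1) ys) ≡ length ys
  sum-1 []       = refl
  sum-1 (_ ∷ ys) = cong suc (sum-1 ys)

length≤∣p∣ : ∀ {n} {X : Subset n} {xs} → Unique xs → (∀ {u} → u ∈ˡ xs → u ∈ X) → length xs ≤ ∣ X ∣
length≤∣p∣ {xs = xs} uq xs⊆X = ≤-trans (≤-reflexive (sym (∣p∣≡length (⟦⟧-enumerates uq))))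
  (p⊆q⇒∣p∣≤∣q∣ (λ u∈ → xs⊆X (∈⟦⟧⁻ xs u∈)))

-- Degrees, boundaries and edge sets

module _ {n : ℕ} where

  e : Graph n → Fin n → Fin n → ℕ
  e G u v = ι (adj G u v)

  deg : Graph n → Fin n → ℕ
  deg G u = #[ adj G u ]

  -- Ordered pairs are counted, so this is twice the number of edges spanned by `X`.
  inner : Graph n → Subset n → ℕ
  inner G X = ∑∈ X (λ u → ∑∈ X (e G u))

  Adj-sym : ∀ (G : Graph n) {u v} → Adj G u v → Adj G v u
  Adj-sym G {u} {v} = subst T (adj-sym G u v)

  Adj-irr : ∀ (G : Graph n) {u v} → Adj G u v → u ≢ v
  Adj-irr G {u} uv refl = subst T (adj-irr G u) uv

  e-sym : ∀ (G : Graph n) u v → e G u v ≡ e G v u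
  e-sym G u v = cong ι (adj-sym G u v)

  e-irr : ∀ (G : Graph n) v → e G v v ≡ 0
  e-irr G v = cong ι (adj-irr G v)

  -- Each neighbour of a vertex of `X` lies either outside `X` or inside it.
  boundary+inner : ∀ (G : Graph n) X → boundary G X + inner G X ≡ ∑∈ X (deg G)
  boundary+inner G X = trans (sym (∑-+ {n} _ _)) (∑-cong row)
    where
    row : ∀ u → ∑ (λ v → ι (lookup X u ∧ not (lookup X v) ∧ adj G u v))
                + (if lookup X u then ∑∈ X (e G u) else 0)
              ≡ (if lookup X u then deg G u else 0)
    row u with lookup X u
    ... | false = trans (+-identityʳ _) (∑-0 {n} λ v → refl)
    ... | true  = trans (sym (∑-+ {n} _ _)) (∑-cong cell)
      where
      cell : ∀ v → ι (not (lookup X v) ∧ adj G u v) + (if lookup X v then e G u v else 0) ≡ e G u v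
      cell v with lookup X v
      ... | false = +-identityʳ _
      ... | true  = refl

  module _ (G : Graph n) {X : Subset n} where

    ∑∈-deg : ∀ {xs} → Enumerates X xs → boundary G X + inner G X ≡ sumˡ (map (deg G) xs)
    ∑∈-deg E = trans (boundary+inner G X) (∑∈-enum E (deg G))

    inner-enum : ∀ {xs} → Enumerates X xs → inner G X ≡ sumˡ (map (λ u → sumˡ (map (e G u) xs)) xs)
    inner-enum {xs} E = trans (∑∈-enum E (λ u → ∑∈ X (e G u)))
      (cong sumˡ (map-cong (λ u → ∑∈-enum E (e G u)) xs))

    boundary₁ : ∀ {a} → Enumerates X (a ∷ []) → boundary G X ≡ deg G a
    boundary₁ {a} E = eliminate (boundary G X) (e-irr G a) (subst
      (λ z → boundary G X + z ≡ deg G a + 0) (inner-enum E) (∑∈-deg E))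
      where
      eliminate : ∀ B {p D} → p ≡ 0 → B + (p + 0 + 0) ≡ D + 0 → B ≡ D
      eliminate B refl eq = trans (sym (+-identityʳ B)) (trans eq (+-identityʳ _))

    boundary₂ : ∀ {a b} → Enumerates X (a ∷ b ∷ []) →
                boundary G X + 2 * e G a b ≡ deg G a + deg G b
    boundary₂ {a} {b} E = eliminate (boundary G X) (e G a b) (deg G a) (deg G b)
      (e-irr G a) (e-irr G b) (e-sym G b a) (subst
      (λ z → boundary G X + z ≡ deg G a + (deg G b + 0)) (inner-enum E) (∑∈-deg E))
      where
      -- The hypothesis is the double sum over the list as it unfolds: `p` and `q` are the diagonal
      -- entries, `x` and `y` the two orientations of the pair.
      eliminate : ∀ B x D₁ D₂ {p q y} → p ≡ 0 → q ≡ 0 → y ≡ x →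
        B + ((p + (x + 0)) + ((y + (q + 0)) + 0)) ≡ D₁ + (D₂ + 0) → B + 2 * x ≡ D₁ + D₂
      eliminate B x D₁ D₂ refl refl refl eq =
        trans (lhs B x) (trans eq (cong (D₁ +_) (+-identityʳ D₂)))
        where
        lhs : ∀ B x → B + 2 * x ≡ B + ((0 + (x + 0)) + ((x + (0 + 0)) + 0))
        lhs = solve-∀

    boundary₃ : ∀ {a b c} → Enumerates X (a ∷ b ∷ c ∷ []) →
                boundary G X + 2 * (e G a b + e G a c + e G b c) ≡ deg G a + deg G b + deg G c
    boundary₃ {a} {b} {c} E = eliminate (boundary G X) (e G a b) (e G a c) (e G b c)
      (deg G a) (deg G b) (deg G c)
      (e-irr G a) (e-irr G b) (e-irr G c) (e-sym G b a) (e-sym G c a) (e-sym G c b) (subst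
      (λ z → boundary G X + z ≡ deg G a + (deg G b + (deg G c + 0))) (inner-enum E) (∑∈-deg E))
      where
      eliminate : ∀ B x y z D₁ D₂ D₃ {p q r x₁ y₁ z₁} →
        p ≡ 0 → q ≡ 0 → r ≡ 0 → x₁ ≡ x → y₁ ≡ y → z₁ ≡ z →
        B + ((p + (x + (y + 0))) + ((x₁ + (q + (z + 0))) + ((y₁ + (z₁ + (r + 0))) + 0)))
          ≡ D₁ + (D₂ + (D₃ + 0)) →
        B + 2 * (x + y + z) ≡ D₁ + D₂ + D₃
      eliminate B x y z D₁ D₂ D₃ refl refl refl refl refl refl eq =
        trans (lhs B x y z) (trans eq (rhs D₁ D₂ D₃))
        where
        lhs : ∀ B x y z → B + 2 * (x + y + z)
          ≡ B + ((0 + (x + (y + 0))) + ((x + (0 + (z + 0))) + ((y + (z + (0 + 0))) + 0)))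
        lhs = solve-∀
        rhs : ∀ x y z → x + (y + (z + 0)) ≡ x + y + z
        rhs = solve-∀

  -- `size` depends on the order of the vertices. Doubling it gives a symmetric count over ordered
  -- pairs, which can be compared with degrees and boundaries.
  size-double : ∀ (F : Graph n) → 2 * size F ≡ #₂[ adj F ]
  size-double F = begin
    2 * size F                    ≡⟨ cong (size F +_) (+-identityʳ _) ⟩
    size F + size F               ≡⟨ cong (size F +_) (∑-swap {n} {n} _) ⟩
    size F + ∑ (λ u → ∑ (λ v → ι ((toℕ v <ᵇ toℕ u) ∧ adj F v u)))  ≡⟨ sym (∑-+ {n} _ _) ⟩
    ∑ (λ u → ∑ (λ v → ι ((toℕ u <ᵇ toℕ v) ∧ adj F u v)) + ∑ (λ v → ι ((toℕ v <ᵇ toℕ u) ∧ adj F v u))) ≡⟨ ∑-cong {n} (λ u → trans (sym (∑-+ {n} _ _)) (∑-cong (cell u))) ⟩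
    #₂[ adj F ]                   ∎
    where
    open ≡-Reasoning
    ≮⇒≡false : ∀ {a b} → ¬ (a < b) → (a <ᵇ b) ≡ false
    ≮⇒≡false {a} {b} a≮b = T-ext (λ t → a≮b (<ᵇ⇒< a b t)) ⊥-elim
    <⇒≡true : ∀ {a b} → a < b → (a <ᵇ b) ≡ true
    <⇒≡true a<b = to T-≡ (<⇒<ᵇ a<b)
    cell : ∀ u v → ι ((toℕ u <ᵇ toℕ v) ∧ adj F u v) + ι ((toℕ v <ᵇ toℕ u) ∧ adj F v u) ≡ e F u v
    cell u v with <-cmp (toℕ u) (toℕ v)
    ... | tri< u<v _ v≮u rewrite <⇒≡true u<v | ≮⇒≡false v≮u = +-identityʳ _
    ... | tri> u≮v _ v<u rewrite <⇒≡true v<u | ≮⇒≡false u≮v = e-sym F v u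
    ... | tri≈ u≮v u≡v _ with toℕ-injective u≡v
    ...   | refl rewrite ≮⇒≡false u≮v = sym (e-irr F u)

  size-cong : ∀ (F F₁ : Graph n) → (∀ u v → adj F u v ≡ adj F₁ u v) → size F ≡ size F₁
  size-cong F F₁ eq = ∑-cong (λ u → ∑-cong (λ v → cong (λ b → ι ((toℕ u <ᵇ toℕ v) ∧ b)) (eq u v)))

  size-mono : ∀ (F F₁ : Graph n) → F ⊆E F₁ → size F ≤ size F₁
  size-mono F F₁ F⊆F₁ = ∑-mono λ u → ∑-mono λ v → ι-mono {(toℕ u <ᵇ toℕ v) ∧ adj F u v} λ t →
    let p , q = to T-∧ t in from T-∧ (p , F⊆F₁ u v q)

  cut : Graph n → Subset n → EdgeSet n
  cut G X = record
    { adj     = λ u v → (lookup X u ∧ not (lookup X v) ∧ adj G u v) ∨ (lookup X v ∧ not (lookup X u) ∧ adj G v u)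
    ; adj-sym = λ u v → ∨-comm (lookup X u ∧ not (lookup X v) ∧ adj G u v) _
    ; adj-irr = λ v → irr (lookup X v) (adj G v v)
    }
    where
    irr : ∀ x a → (x ∧ not x ∧ a) ∨ (x ∧ not x ∧ a) ≡ false
    irr false a = refl
    irr true  a = refl

  cut-size : ∀ (G : Graph n) X → size (cut G X) ≡ boundary G X
  cut-size G X = *-cancelˡ-≡ _ _ 2 (begin
    2 * size (cut G X)              ≡⟨ size-double (cut G X) ⟩
    #₂[ adj (cut G X) ]             ≡⟨ ∑-cong (λ u → ∑-cong (cell u)) ⟩
    ∑ (λ u → ∑ (λ v → d u v + d v u)) ≡⟨ ∑-cong (λ u → ∑-+ (d u) _) ⟩
    ∑ (λ u → ∑ (d u) + ∑ (λ v → d v u)) ≡⟨ ∑-+ {n} _ _ ⟩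
    boundary G X + ∑ (λ u → ∑ (λ v → d v u)) ≡⟨ cong (boundary G X +_) (sym (∑-swap d)) ⟩
    boundary G X + boundary G X     ≡⟨ cong (boundary G X +_) (sym (+-identityʳ _)) ⟩
    2 * boundary G X                ∎)
    where
    open ≡-Reasoning
    d : Fin n → Fin n → ℕ
    d u v = ι (lookup X u ∧ not (lookup X v) ∧ adj G u v)
    cell : ∀ u v → e (cut G X) u v ≡ d u v + d v u
    cell u v with lookup X u | lookup X v
    ... | false | false = refl
    ... | false | true  = refl
    ... | true  | false rewrite +-identityʳ (ι (adj G u v)) = ∨-falseʳ (adj G u v)
      where
      ∨-falseʳ : ∀ b → ι (b ∨ false) ≡ ι b
      ∨-falseʳ false = refl
      ∨-falseʳ true  = refl
    ... | true  | true  = refl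

  cut⁺ : ∀ (G : Graph n) X {u v} → u ∈ X → v ∉ X → Adj G u v → Adj (cut G X) u v
  cut⁺ G X u∈X v∉X uv = from T-∨ (inj₁ (from T-∧ (∈⇒T u∈X , from T-∧ (T-not (v∉X ∘ T⇒∈) , uv))))

  cut⁻ : ∀ (G : Graph n) X {u v} → Adj (cut G X) u v →
         Adj G u v × ((u ∈ X × v ∉ X) ⊎ (v ∈ X × u ∉ X))
  cut⁻ G X {u} {v} t with to (T-∨ {lookup X u ∧ not (lookup X v) ∧ adj G u v}) t
  ... | inj₁ s = let p , r = to (T-∧ {lookup X u}) s ; q , a = to (T-∧ {not (lookup X v)}) r in
                 a , inj₁ (T⇒∈ p , λ v∈X → T-not⁻ q (∈⇒T v∈X))
  ... | inj₂ s = let p , r = to (T-∧ {lookup X v}) s ; q , a = to (T-∧ {not (lookup X u)}) r in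
                 Adj-sym G a , inj₂ (T⇒∈ p , λ u∈X → T-not⁻ q (∈⇒T u∈X))

  boundary≤size : ∀ (F : Graph n) X → boundary F X ≤ size F
  boundary≤size F X = ≤-trans (≤-reflexive (sym (cut-size F X)))
    (size-mono (cut F X) F (λ u v t → proj₁ (cut⁻ F X t)))

  deg-within : ∀ (G : Graph n) {X xs w} → Enumerates X xs → (∀ {x} → Adj G w x → x ∈ X) →
               deg G w ≡ sumˡ (map (e G w) xs)
  deg-within G {X} {xs} {w} E nb = trans (∑-cong cell) (∑∈-enum E (e G w))
    where
    cell : ∀ x → e G w x ≡ (if lookup X x then e G w x else 0)
    cell x with lookup X x in eq
    ... | true  = refl
    ... | false = ι≡0 (λ a → subst T eq (∈⇒T (nb a)))

  -- Pigeonhole: if all neighbours of `w` occurred in `xs`, its row of the adjacency matrix would be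
  -- dominated by `occurrences xs`, whose sum is the length of `xs`.
  ∃-neighbour∉ : ∀ (G : Graph n) w xs → length xs < deg G w → ∃[ v ] Adj G w v × v ∉ˡ xs
  ∃-neighbour∉ G w xs len< with any? (λ v → T? (adj G w v) ×-dec ¬? (v ∈ˡ? xs))
  ... | yes (v , p) = v , p
  ... | no none = contradiction deg≤ (<⇒≱ len<)
    where
    cell : ∀ v → e G w v ≤ occurrences xs v
    cell v = ι-≤ (λ a → hit a (v ∈ˡ? xs))
      where
      hit : Adj G w v → Dec (v ∈ˡ xs) → 1 ≤ occurrences xs v
      hit a (yes v∈) = ∈⇒occurrences v∈
      hit a (no v∉)  = ⊥-elim (none (v , a , v∉))
    deg≤ : deg G w ≤ length xs
    deg≤ = ≤-trans (∑-mono cell) (≤-reflexive (∑-occurrences xs))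

-- Components and extra edge-cuts

module _ {n : ℕ} where

  Closed : Graph n → Subset n → Set
  Closed G Y = ∀ {u v} → u ∈ Y → Adj G u v → v ∈ Y

  closed-star : ∀ (G : Graph n) {Y u v} → Closed G Y → u ∈ Y → Star (Adj G) u v → v ∈ Y
  closed-star G cl u∈Y ε        = u∈Y
  closed-star G cl u∈Y (a ◅ as) = closed-star G cl (cl u∈Y a) as

  Star-sym : ∀ (G : Graph n) {u v} → Star (Adj G) u v → Star (Adj G) v u
  Star-sym G ε        = ε
  Star-sym G (a ◅ as) = Star-sym G as ◅◅ (Adj-sym G a ◅ ε)

  -- `m` is fuel: it bounds the number of vertices still outside `S`. Each round absorbs one vertex
  -- across an edge leaving `S`, and once the fuel is spent there is no vertex left to absorb.
  saturate : ∀ (G : Graph n) u m S → n ≤ ∣ S ∣ + m → u ∈ S → (∀ {v} → v ∈ S → Star (Adj G) u v) →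
             ∃[ C ] u ∈ C × Closed G C × (∀ {v} → v ∈ C → Star (Adj G) u v)
  saturate G u m S n≤ u∈S reach
    with any? (λ a → any? (λ b → (a ∈? S) ×-dec ¬? (b ∈? S) ×-dec T? (adj G a b)))
  ... | no none = S , u∈S , closed , reach
    where
    closed : Closed G S
    closed {a} {b} a∈S ab with b ∈? S
    ... | yes b∈S = b∈S
    ... | no b∉S  = ⊥-elim (none (a , b , a∈S , b∉S , ab))
  ... | yes (a , b , a∈S , b∉S , ab) = grow m n≤
    where
    S<S∪b : ∣ S ∣ < ∣ S ∪ ⁅ b ⁆ ∣
    S<S∪b = p⊂q⇒∣p∣<∣q∣ ((λ x∈ → x∈p∪q⁺ (inj₁ x∈)) , b , x∈p∪q⁺ (inj₂ (x∈⁅x⁆ b)) , b∉S)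
    reach′ : ∀ {v} → v ∈ S ∪ ⁅ b ⁆ → Star (Adj G) u v
    reach′ v∈ with x∈p∪q⁻ S ⁅ b ⁆ v∈
    ... | inj₁ v∈S = reach v∈S
    ... | inj₂ v∈b rewrite x∈⁅y⁆⇒x≡y b v∈b = reach a∈S ◅◅ (ab ◅ ε)
    grow : ∀ m → n ≤ ∣ S ∣ + m → _
    grow zero n≤ = ⊥-elim (<-irrefl refl (≤-trans S<S∪b
      (≤-trans (∣p∣≤n (S ∪ ⁅ b ⁆)) (≤-trans n≤ (≤-reflexive (+-identityʳ _))))))
    grow (suc m) n≤ = saturate G u m (S ∪ ⁅ b ⁆)
      (≤-trans n≤ (≤-trans (≤-reflexive (+-suc ∣ S ∣ m)) (+-monoˡ-≤ m S<S∪b)))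
      (x∈p∪q⁺ (inj₁ u∈S)) reach′

  component : ∀ (G : Graph n) u → ∃[ C ] u ∈ C × IsComponent G C
  component G u with saturate G u n ⁅ u ⁆ (m≤n+m n _) (x∈⁅x⁆ u) (λ v∈ → subst (Star (Adj G) u) (sym (x∈⁅y⁆⇒x≡y u v∈)) ε)
  ... | C , u∈C , cl , reach = C , u∈C , (u , u∈C) , λ w w∈C v →
    mk⇔ (λ v∈C → Star-sym G (reach w∈C) ◅◅ reach v∈C) (closed-star G cl w∈C)

  component-closed : ∀ (G : Graph n) {C} → IsComponent G C → Closed G C
  component-closed G (_ , iff) {u} {v} u∈C uv = from (iff u u∈C v) (uv ◅ ε)

  component⊆ : ∀ (G : Graph n) {C Y u} → IsComponent G C → Closed G Y → u ∈ C → u ∈ Y → C ⊆ Y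
  component⊆ G {u = u} (_ , iff) cl u∈C u∈Y {v} v∈C = closed-star G cl u∈Y (to (iff u u∈C v) v∈C)

  Disconnection : Graph n → Subset n → Set
  Disconnection G Y = Nonempty Y × Closed G Y × ∃[ v ] v ∉ Y

  disconnection⇒¬connected : ∀ (G : Graph n) {Y} → Disconnection G Y → ¬ Connected G
  disconnection⇒¬connected G ((u , u∈Y) , cl , v , v∉Y) con = v∉Y (closed-star G cl u∈Y (con u v))

  connected? : ∀ (G : Graph n) → Connected G ⊎ (∃[ Y ] Disconnection G Y)
  connected? G with any? (λ u → any? (λ v → ¬? (v ∈? proj₁ (component G u))))
  ... | yes (u , v , v∉C) = let C , u∈C , comp = component G u in
                            inj₂ (C , (u , u∈C) , component-closed G comp , v , v∉C)
  ... | no none = inj₁ λ u v → let C , u∈C , (_ , iff) = component G u in to (iff u u∈C v) (inside u v)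
    where
    inside : ∀ u v → v ∈ proj₁ (component G u)
    inside u v with v ∈? proj₁ (component G u)
    ... | yes v∈C = v∈C
    ... | no v∉C  = ⊥-elim (none (u , v , v∉C))

  -- Extra edge-cuts through closed sets (unions of components) instead of
  -- components: a description that is decidable without reference to paths.
  ClosedCut : ℕ → Graph n → EdgeSet n → Set
  ClosedCut h G F = F ⊆E G × (∃[ Y ] Disconnection (G ∖ F) Y)
                  × (∀ Y → Nonempty Y → Closed (G ∖ F) Y → h < ∣ Y ∣)

  closedCut⇒cut : ∀ {h} {G : Graph n} {F} → ClosedCut h G F → IsExtraEdgeCut h G F
  closedCut⇒cut {G = G} {F} (F⊆G , (Y , d) , large) =
    F⊆G , disconnection⇒¬connected (G ∖ F) d ,
    λ C comp → large C (proj₁ comp) (component-closed (G ∖ F) comp)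

  -- A nonempty closed set contains the whole component of any of its vertices, and so inherits the
  -- lower bound on its size.
  cut⇒closedCut : ∀ {h} {G : Graph n} {F} → IsExtraEdgeCut h G F → ClosedCut h G F
  cut⇒closedCut {h} {G} {F} (F⊆G , ¬con , large) = F⊆G , disc , λ Y (u , u∈Y) cl →
    let C , u∈C , comp = component (G ∖ F) u in
    ≤-trans (large C comp) (p⊆q⇒∣p∣≤∣q∣ (component⊆ (G ∖ F) comp cl u∈C u∈Y))
    where
    disc : ∃[ Y ] Disconnection (G ∖ F) Y
    disc with connected? (G ∖ F)
    ... | inj₁ con = ⊥-elim (¬con con)
    ... | inj₂ d   = d

  ∖⁺ : ∀ (G F : Graph n) {u v} → Adj G u v → ¬ Adj F u v → Adj (G ∖ F) u v
  ∖⁺ G F uv ¬uv = from T-∧ (uv , T-not ¬uv)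

  ∖⁻ : ∀ (G F : Graph n) {u v} → Adj (G ∖ F) u v → Adj G u v × ¬ Adj F u v
  ∖⁻ G F {u} {v} t = let p , q = to (T-∧ {adj G u v}) t in p , T-not⁻ q

  -- Every edge of `G` that leaves a set closed in `G ∖ F` must belong to `F`.
  closed⇒boundary≤ : ∀ (G F : Graph n) {Y} → Closed (G ∖ F) Y → boundary G Y ≤ size F
  closed⇒boundary≤ G F {Y} cl = ≤-trans (≤-reflexive (sym (cut-size G Y))) (size-mono (cut G Y) F sub)
    where
    hit : ∀ {u v} → u ∈ Y → v ∉ Y → Adj G u v → Adj F u v
    hit {u} {v} u∈Y v∉Y uv with T? (adj F u v)
    ... | yes f = f
    ... | no ¬f = ⊥-elim (v∉Y (cl u∈Y (∖⁺ G F uv ¬f)))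
    sub : cut G Y ⊆E F
    sub u v t with cut⁻ G Y t
    ... | uv , inj₁ (u∈Y , v∉Y) = hit u∈Y v∉Y uv
    ... | uv , inj₂ (v∈Y , u∉Y) = Adj-sym F (hit v∈Y u∉Y (Adj-sym G uv))

  cut-closed : ∀ (G : Graph n) X → Closed (G ∖ cut G X) X
  cut-closed G X {u} {v} u∈X t with v ∈? X
  ... | yes v∈X = v∈X
  ... | no v∉X  = let uv , ¬c = ∖⁻ G (cut G X) t in ⊥-elim (¬c (cut⁺ G X u∈X v∉X uv))

  cut⊆ : ∀ (G : Graph n) X → cut G X ⊆E G
  cut⊆ G X u v t = proj₁ (cut⁻ G X t)

  _∪E_ : EdgeSet n → EdgeSet n → EdgeSet n
  F ∪E F₁ = record
    { adj     = λ u v → adj F u v ∨ adj F₁ u v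
    ; adj-sym = λ u v → cong₂ _∨_ (adj-sym F u v) (adj-sym F₁ u v)
    ; adj-irr = λ v → cong₂ _∨_ (adj-irr F v) (adj-irr F₁ v)
    }

  size-∪ : ∀ (F F₁ : Graph n) → (∀ {u v} → Adj F u v → ¬ Adj F₁ u v) → size (F ∪E F₁) ≡ size F + size F₁
  size-∪ F F₁ disj = trans (∑-cong {n} λ u → trans (∑-cong {n} λ v →
      cell (toℕ u <ᵇ toℕ v) (adj F u v) (adj F₁ u v) disj)
      (∑-+ {n} (λ v → ι ((toℕ u <ᵇ toℕ v) ∧ adj F u v)) (λ v → ι ((toℕ u <ᵇ toℕ v) ∧ adj F₁ u v))))
      (∑-+ {n} (λ u → ∑ (λ v → ι ((toℕ u <ᵇ toℕ v) ∧ adj F u v)))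
               (λ u → ∑ (λ v → ι ((toℕ u <ᵇ toℕ v) ∧ adj F₁ u v))))
    where
    cell : ∀ l a b → (T a → ¬ T b) → ι (l ∧ (a ∨ b)) ≡ ι (l ∧ a) + ι (l ∧ b)
    cell false a     b     _ = refl
    cell true  false b     _ = refl
    cell true  true  false _ = refl
    cell true  true  true  f = ⊥-elim (f _ _)

-- Removing edges in two stages

-- `H` is only required to agree with `G ∖ F` entry by entry. In this way `G` itself is covered as
-- the case `F = ∅`, although `G ∖ ∅` is not the same record as `G`.
record Split {n} (G F H : Graph n) : Set where
  field
    F⊆G   : F ⊆E G
    H≡G∖F : ∀ u v → adj H u v ≡ adj (G ∖ F) u v

  H⇒G∖F : ∀ {u v} → Adj H u v → Adj (G ∖ F) u v
  H⇒G∖F {u} {v} = subst T (H≡G∖F u v)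

  G∖F⇒H : ∀ {u v} → Adj (G ∖ F) u v → Adj H u v
  G∖F⇒H {u} {v} = subst T (sym (H≡G∖F u v))

  H⇒G : ∀ {u v} → Adj H u v → Adj G u v
  H⇒G uv = proj₁ (∖⁻ G F (H⇒G∖F uv))

  H⇒¬F : ∀ {u v} → Adj H u v → ¬ Adj F u v
  H⇒¬F uv = proj₂ (∖⁻ G F (H⇒G∖F uv))

  e-split : ∀ u v → e G u v ≡ e H u v + e F u v
  e-split u v rewrite H≡G∖F u v = cell (adj G u v) (adj F u v) (F⊆G u v)
    where
    cell : ∀ g f → (T f → T g) → ι g ≡ ι (g ∧ not f) + ι f
    cell false false _ = refl
    cell false true  h = ⊥-elim (h _)
    cell true  false _ = refl
    cell true  true  _ = refl

  deg-split : ∀ u → deg G u ≡ deg H u + deg F u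
  deg-split u = trans (∑-cong {n} (e-split u)) (∑-+ {n} (e H u) (e F u))

  closed-G∖F : ∀ {Y} → Closed H Y → Closed (G ∖ F) Y
  closed-G∖F cl u∈Y uv = cl u∈Y (G∖F⇒H uv)

∖-split : ∀ {n} (G F : Graph n) → F ⊆E G → Split G F (G ∖ F)
∖-split G F F⊆G = record { F⊆G = F⊆G ; H≡G∖F = λ u v → refl }

∅ : ∀ {n} → EdgeSet n
∅ = record { adj = λ _ _ → false ; adj-sym = λ _ _ → refl ; adj-irr = λ _ → refl }

∅-split : ∀ {n} (G : Graph n) → Split G ∅ G
∅-split G = record { F⊆G = λ _ _ () ; H≡G∖F = λ u v → sym (∧-identityʳ (adj G u v)) }

size-∅ : ∀ {n} → size {n} ∅ ≡ 0
size-∅ {n} = ∑-0 {n} λ u → ∑-0 {n} λ v → cong ι (∧-zeroʳ (toℕ u <ᵇ toℕ v))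

∪-transfer : ∀ {n} {G F H : Graph n} (F′ : EdgeSet n) → Split G F H →
             ∀ u v → adj (H ∖ F′) u v ≡ adj (G ∖ (F ∪E F′)) u v
∪-transfer {G = G} {F} F′ s u v rewrite Split.H≡G∖F s u v = cell (adj G u v) (adj F u v) (adj F′ u v)
  where
  cell : ∀ g f f′ → (g ∧ not f) ∧ not f′ ≡ g ∧ not (f ∨ f′)
  cell false f     f′ = refl
  cell true  false f′ = refl
  cell true  true  f′ = refl

closed-≗ : ∀ {n} {G H : Graph n} {Y} → (∀ u v → adj G u v ≡ adj H u v) → Closed G Y → Closed H Y
closed-≗ eq cl {u} {v} u∈Y uv = cl u∈Y (subst T (sym (eq u v)) uv)

∪-closedCut : ∀ {n h} {G F H F′ : Graph n} → Split G F H → ClosedCut h H F′ → ClosedCut h G (F ∪E F′)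
∪-closedCut {G = G} {F} {H} {F′} s (F′⊆H , (Y , ne , cl , out) , large) =
    (λ u v t → [ Split.F⊆G s u v , (λ f → Split.H⇒G s (F′⊆H u v f)) ]′ (to T-∨ t))
  , (Y , ne , closed-≗ {G = H ∖ F′} {G ∖ (F ∪E F′)} eq cl , out)
  , λ Z neZ clZ → large Z neZ (closed-≗ {G = G ∖ (F ∪E F′)} {H ∖ F′} (λ u v → sym (eq u v)) clZ)
  where
  eq : ∀ u v → adj (H ∖ F′) u v ≡ adj (G ∖ (F ∪E F′)) u v
  eq = ∪-transfer F′ s

closedCut-size : ∀ {n h} {G F H F′ : Graph n} → Split G F H → ClosedCut h H F′ →
                 size (F ∪E F′) ≡ size F + size F′
closedCut-size {F = F} {H} {F′} s (F′⊆H , _) = size-∪ F F′ (λ {u} {v} f f′ → Split.H⇒¬F s (F′⊆H u v f′) f)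

-- The edge criterion for super-λ′

least : ∀ {P : ℕ → Set} → Decidable P → ∀ {m} → P m → ∃[ l ] IsMinimum P l
least {P} P? {m} pm with search (suc m)
  where
  search : ∀ b → (∃[ l ] IsMinimum P l) ⊎ (∀ j → j < b → ¬ P j)
  search zero = inj₂ λ _ ()
  search (suc b) with search b
  ... | inj₁ found = inj₁ found
  ... | inj₂ none with P? b
  ...   | yes pb = inj₁ (b , pb , λ j pj → ≮⇒≥ (λ j<b → none j j<b pj))
  ...   | no ¬pb = inj₂ λ j j<1+b pj → [ (λ j<b → none j j<b pj) , (λ { refl → ¬pb pj }) ]′
                     (m≤n⇒m<n∨m≡n (≤-pred j<1+b))
... | inj₁ found = found
... | inj₂ none  = ⊥-elim (none m ≤-refl pm)

module _ {n : ℕ} where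

  closed? : ∀ (G : Graph n) Y → Dec (Closed G Y)
  closed? G Y = map′ (λ f {u} {v} → f u v) (λ f u v → f {u} {v})
    (all? λ u → all? λ v → (u ∈? Y) →-dec (T? (adj G u v) →-dec (v ∈? Y)))

  small-closed? : ∀ (G : Graph n) → (∃[ Y ] Nonempty Y × Closed G Y × ∣ Y ∣ ≤ 2)
                                  ⊎ (∀ Y → Nonempty Y → Closed G Y → 2 < ∣ Y ∣)
  small-closed? G with anySubset? (λ Y → nonempty? Y ×-dec closed? G Y ×-dec (∣ Y ∣ ≤? 2))
  ... | yes small = inj₁ small
  ... | no none   = inj₂ λ Y ne cl → ≰⇒> (λ Y≤2 → none (Y , ne , cl , Y≤2))

  enumerates⇒≡ : ∀ {X : Subset n} {xs} → Enumerates X xs → ⟦ xs ⟧ ≡ X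
  enumerates⇒≡ {X} {xs} E = ⊆-antisym (λ u∈ → ∈ˡ⇒∈ E (∈⟦⟧⁻ xs u∈)) (λ u∈ → ∈⟦⟧⁺ (∈⇒∈ˡ E u∈))

  elements₂ : ∀ {X : Subset n} → ∣ X ∣ ≡ 2 → ∃[ a ] ∃[ b ] Enumerates X (a ∷ b ∷ [])
  elements₂ {X} ∣X∣≡2 = let xs , E = elements X in go xs E (trans (sym (∣p∣≡length E)) ∣X∣≡2)
    where
    go : ∀ xs → Enumerates X xs → length xs ≡ 2 → ∃[ a ] ∃[ b ] Enumerates X (a ∷ b ∷ [])
    go (a ∷ b ∷ []) E refl = a , b , E

  elements₃ : ∀ {X : Subset n} → ∣ X ∣ ≡ 3 → ∃[ a ] ∃[ b ] ∃[ c ] Enumerates X (a ∷ b ∷ c ∷ [])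
  elements₃ {X} ∣X∣≡3 = let xs , E = elements X in go xs E (trans (sym (∣p∣≡length E)) ∣X∣≡3)
    where
    go : ∀ xs → Enumerates X xs → length xs ≡ 3 → ∃[ a ] ∃[ b ] ∃[ c ] Enumerates X (a ∷ b ∷ c ∷ [])
    go (a ∷ b ∷ c ∷ []) E refl = a , b , c , E

  pair : Fin n → Fin n → Subset n
  pair u v = ⟦ u ∷ v ∷ [] ⟧

  pair-enum : ∀ {u v} → u ≢ v → Enumerates (pair u v) (u ∷ v ∷ [])
  pair-enum u≢v = ⟦⟧-enumerates ((u≢v ∷ []) ∷ [] ∷ [])

  edge-boundary : ∀ (G : Graph n) {u v} → Adj G u v → boundary G (pair u v) + 2 ≡ deg G u + deg G v
  edge-boundary G {u} {v} uv = trans (cong (λ z → boundary G (pair u v) + 2 * z) (sym (ι≡1 uv)))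
    (boundary₂ G (pair-enum (Adj-irr G uv)))

  e≤deg : ∀ (G : Graph n) u v → e G u v ≤ deg G u
  e≤deg G u v = ≤-trans (≤-reflexive (sym (∑-if v (e G u)))) (∑-mono cell)
    where
    cell : ∀ x → (if does (v ≟ x) then e G u x else 0) ≤ e G u x
    cell x with does (v ≟ x)
    ... | true  = ≤-refl
    ... | false = z≤n

  pair-edge : ∀ (H : Graph n) {X a b} → Enumerates X (a ∷ b ∷ []) → InducedConnected H X → Adj H a b
  pair-edge H {X} {a} {b} E con with unique E
  ... | (a≢b ∷ []) ∷ _ = first (con a b (∈ˡ⇒∈ E (here refl)) (∈ˡ⇒∈ E (there (here refl))))
    where
    first : Star (λ x y → x ∈ X × y ∈ X × Adj H x y) a b → Adj H a b
    first ε = ⊥-elim (a≢b refl)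
    first ((_ , c∈X , ac) ◅ _) with ∈⇒∈ˡ E c∈X
    ... | here refl         = ⊥-elim (Adj-irr H ac refl)
    ... | there (here refl) = ac

  edge-connected : ∀ (H : Graph n) {a b} → Adj H a b → InducedConnected H (pair a b)
  edge-connected H {a} {b} ab u v u∈ v∈ with ∈⟦⟧⁻ (a ∷ b ∷ []) u∈ | ∈⟦⟧⁻ (a ∷ b ∷ []) v∈
  ... | here refl         | here refl         = ε
  ... | here refl         | there (here refl) = (u∈ , v∈ , ab) ◅ ε
  ... | there (here refl) | here refl         = (u∈ , v∈ , Adj-sym H ab) ◅ ε
  ... | there (here refl) | there (here refl) = ε

  BeatenByEdge : Graph n → ℕ → Set
  BeatenByEdge H s = ∃[ u ] ∃[ v ] Adj H u v × boundary H (pair u v) < s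

  closedCut-2⇒1 : ∀ {H F : Graph n} → ClosedCut 2 H F → ClosedCut 1 H F
  closedCut-2⇒1 (F⊆H , disc , large) = F⊆H , disc , λ Y ne cl → <⇒≤ (large Y ne cl)

  -- The edge attains ξ₁ = λ′ ≤ |F|. Equality would make `F` a λ′-cut, hence leave a component of
  -- two vertices, which a 2-extra edge-cut does not allow.
  super⇒beaten : ∀ {H F : Graph n} → IsSuperλ 1 H → ClosedCut 2 H F → BeatenByEdge H (size F)
  super⇒beaten {H} {F} (_ , (m , λ-min@(_ , min) , (X , ∣X∣≡2 , con , bd≡m) , _) , sup) cut₂@(_ , _ , large)
    with elements₂ ∣X∣≡2
  ... | a , b , E = a , b , pair-edge H E con ,
    subst (_< size F) (trans (sym bd≡m) (cong (boundary H) (sym (enumerates⇒≡ E)))) m<size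
    where
    extra : IsExtraEdgeCut 1 H F
    extra = closedCut⇒cut {G = H} {F} (closedCut-2⇒1 {H} {F} cut₂)
    m<size : m < size F
    m<size with m≤n⇒m<n∨m≡n (min (size F) (F , extra , refl))
    ... | inj₁ m<s = m<s
    ... | inj₂ m≡s with sup F (extra , subst (Isλ 1 H) m≡s λ-min)
    ...   | C , comp , ∣C∣≡2 = ⊥-elim (<-irrefl (sym ∣C∣≡2)
              (large C (proj₁ comp) (component-closed (H ∖ F) comp)))

  -- If `a` and `b` were not adjacent, `a` alone would be closed, contrary to the bound on the size
  -- of closed sets.
  closed-pair-edge : ∀ {H F : Graph n} → ClosedCut 1 H F → ∀ {a b Y} → Enumerates Y (a ∷ b ∷ []) →
                     Closed (H ∖ F) Y → Adj H a b
  closed-pair-edge {H} {F} (_ , _ , large) {a} {b} E cl with T? (adj H a b)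
  ... | yes ab = ab
  ... | no ¬ab = ⊥-elim (<-irrefl (sym (∣⁅x⁆∣≡1 a)) (large ⁅ a ⁆ (a , x∈⁅x⁆ a) closed))
    where
    closed : Closed (H ∖ F) ⁅ a ⁆
    closed {u} {v} u∈ uv with x∈⁅y⁆⇒x≡y a u∈
    ... | refl with ∈⇒∈ˡ E (cl (∈ˡ⇒∈ E (here refl)) uv)
    ...   | here refl         = u∈
    ...   | there (here refl) = ⊥-elim (¬ab (proj₁ (∖⁻ H F uv)))

  -- Either some closed set has at most two vertices, in which case it is an edge whose boundary
  -- lies in `F`, or `F` is already a 2-extra edge-cut.
  cut-attains-or-beaten : ∀ {H F : Graph n} → ClosedCut 1 H F → (ClosedCut 2 H F → BeatenByEdge H (size F)) →
    (∃[ a ] ∃[ b ] Adj H a b × boundary H (pair a b) ≤ size F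
       × (∃[ Y ] Nonempty Y × Closed (H ∖ F) Y × ∣ Y ∣ ≤ 2))
    ⊎ BeatenByEdge H (size F)
  cut-attains-or-beaten {H} {F} c@(F⊆H , disc , large) beaten with small-closed? (H ∖ F)
  ... | inj₂ big = inj₂ (beaten (F⊆H , disc , big))
  ... | inj₁ (Y , ne@(y , y∈Y) , cl , Y≤2) with elements₂ (≤-antisym Y≤2 (large Y ne cl))
  ...   | a , b , E = inj₁ (a , b , closed-pair-edge {H} {F} c E cl ,
    subst (λ X → boundary H X ≤ size F) (sym (enumerates⇒≡ E)) (closed⇒boundary≤ H F cl) ,
    Y , ne , cl , Y≤2)

  MinEdge : Graph n → Fin n → Fin n → Set
  MinEdge H u v = Adj H u v × (∀ x y → Adj H x y → boundary H (pair u v) ≤ boundary H (pair x y))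

  min-edge : ∀ (H : Graph n) {u v} → Adj H u v → ∃[ x ] ∃[ y ] MinEdge H x y
  min-edge H {u} {v} uv with least
      (λ m → any? (λ x → any? (λ y → T? (adj H x y) ×-dec (boundary H (pair x y) ≟ℕ m))))
      (u , v , uv , refl)
  ... | _ , (x , y , xy , refl) , min = x , y , xy , λ x′ y′ a → min _ (x′ , y′ , a , refl)

  -- The cut around a minimum edge is the witness for λ′ and the edge is the witness for ξ₁. A cut
  -- beaten by some edge is larger than this witness, so it is not a λ′-cut; every λ′-cut therefore
  -- leaves a closed pair.
  beaten⇒super : ∀ {H : Graph n} → Connected H → ∀ {u v} → MinEdge H u v → ClosedCut 1 H (cut H (pair u v)) →
    (∀ F → ClosedCut 2 H F → BeatenByEdge H (size F)) → IsSuperλ 1 H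
  beaten⇒super {H} con {u} {v} (uv , min) c beaten =
      con
    , (boundary H (pair u v)
      , ((cut H (pair u v) , closedCut⇒cut {G = H} {cut H (pair u v)} c , cut-size H (pair u v)) , λ-lower)
      , ((pair u v , ∣p∣≡length (pair-enum (Adj-irr H uv)) , edge-connected H uv , refl) , ξ-lower))
    , sup
    where
    λ-lower : ∀ j → (∃[ F ] IsExtraEdgeCut 1 H F × size F ≡ j) → boundary H (pair u v) ≤ j
    λ-lower j (F , x , refl) with cut-attains-or-beaten {H} {F} (cut⇒closedCut {G = H} {F} x) (beaten F)
    ... | inj₁ (a , b , ab , bd≤ , _) = ≤-trans (min a b ab) bd≤
    ... | inj₂ (a , b , ab , bd<)     = ≤-trans (min a b ab) (<⇒≤ bd<)
    ξ-lower : ∀ j → (∃[ X ] ∣ X ∣ ≡ 2 × InducedConnected H X × boundary H X ≡ j) → boundary H (pair u v) ≤ j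
    ξ-lower j (X , ∣X∣≡2 , ic , refl) with elements₂ ∣X∣≡2
    ... | a , b , E = subst (λ Z → boundary H (pair u v) ≤ boundary H Z) (enumerates⇒≡ E)
                                  (min a b (pair-edge H E ic))
    sup : ∀ F → IsλCut 1 H F → ∃[ C ] IsComponent (H ∖ F) C × ∣ C ∣ ≡ 2
    sup F (x@(_ , _ , large) , _ , λ-min) with cut-attains-or-beaten {H} {F} (cut⇒closedCut {G = H} {F} x) (beaten F)
    -- The component of `y` lies in the closed set `Y` of at most two vertices, and a 1-extra
    -- edge-cut leaves no smaller one.
    ... | inj₁ (_ , _ , _ , _ , Y , (y , y∈Y) , cl , Y≤2) =
      let C , y∈C , comp = component (H ∖ F) y in
      C , comp , ≤-antisym (≤-trans (p⊆q⇒∣p∣≤∣q∣ (component⊆ (H ∖ F) comp cl y∈C y∈Y)) Y≤2) (large C comp)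
    ... | inj₂ (a , b , ab , bd<) = ⊥-elim (<⇒≱ bd< (≤-trans
      (λ-min _ (cut H (pair u v) , closedCut⇒cut {G = H} {cut H (pair u v)} c , cut-size H (pair u v))) (min a b ab)))

-- Graphs from which few edges are removed

TriangleFree : ∀ {n} → Graph n → Set
TriangleFree G = ∀ {a b c} → Adj G a b → Adj G b c → ¬ Adj G a c

-- m is the number of edges whose loss is to be tolerated.
data Regime {n} (G : Graph n) (k m : ℕ) : Set where
  triangle-free : TriangleFree G → m + 1 ≡ k → 4 ≤ k → Regime G k m
  general       : m + 3 ≡ k → 5 ≤ k → Regime G k m

module Degrees {n k : ℕ} {G F H : Graph n} (regular : Regular G k) (s : Split G F H) where

  open Split s

  degree : ∀ u → deg H u + deg F u ≡ k
  degree u = trans (sym (deg-split u)) (regular u)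

  degree≤ : ∀ u → deg H u ≤ k
  degree≤ u = ≤-trans (m≤m+n _ _) (≤-reflexive (degree u))

  degree₁ : ∀ u → k ≤ deg H u + size F
  degree₁ u = ≤-trans (≤-reflexive (sym (degree u))) (+-monoʳ-≤ (deg H u)
    (≤-trans (≤-reflexive (sym (boundary₁ F (⟦⟧-enumerates ([] ∷ []))))) (boundary≤size F ⟦ u ∷ [] ⟧)))

  degree₂ : ∀ {a b} → a ≢ b → k + k ≤ deg H a + deg H b + (size F + 2 * e F a b)
  degree₂ {a} {b} a≢b =
    degree-sum₂ {ha = deg H a} {deg H b} {deg F a} {deg F b} (degree a) (degree b) (boundary₂ F (pair-enum a≢b)) (boundary≤size F (pair a b))

  -- No edge of `F` lies inside the triple, so each one costs the three degrees at most 1 in total.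
  -- For the pair above, an edge of `F` between `a` and `b` costs 2, hence the additional term
  -- there.
  degree₃ : ∀ {X a b c} → Enumerates X (a ∷ b ∷ c ∷ []) →
            ¬ Adj F a b → ¬ Adj F a c → ¬ Adj F b c →
            k + k + k ≤ deg H a + deg H b + deg H c + size F
  degree₃ {X} {a} {b} {c} E ¬ab ¬ac ¬bc =
    degree-sum₃ {ha = deg H a} {deg H b} {deg H c} {deg F a} {deg F b} {deg F c} (degree a) (degree b) (degree c) (boundary₃ F E)
      (cong₂ _+_ (cong₂ _+_ (ι≡0 ¬ab) (ι≡0 ¬ac)) (ι≡0 ¬bc)) (boundary≤size F X)

  double-e≤2 : ∀ (K : Graph n) a b → 2 * e K a b ≤ 2
  double-e≤2 K a b = *-monoʳ-≤ 2 (ι≤1 (adj K a b))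

  -- Closed sets of H have boundary at most |F| < k in G, so they have more than
  -- two vertices, and F would be a 2-extra edge-cut of G smaller than λ″.
  connected : ∀ {Λ} → 4 ≤ k → Isλ 2 G Λ → k ≤ Λ → size F < k → Connected H
  connected {Λ} 4≤k (_ , λ-min) k≤Λ F<k with connected? H
  ... | inj₁ con = con
  ... | inj₂ (Y , ne , cl , out) with small-closed? (G ∖ F)
  ...   | inj₂ large = ⊥-elim (<⇒≱ F<k (≤-trans k≤Λ (λ-min (size F)
            (F , closedCut⇒cut {G = G} {F} (F⊆G , (Y , ne , closed-G∖F cl , out) , large) , refl))))
  ...   | inj₁ (Z , (z , z∈Z) , clZ , Z≤2) = ⊥-elim (small (proj₁ (elements Z)) (proj₂ (elements Z)))
    where
    B≤ : boundary G Z ≤ size F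
    B≤ = closed⇒boundary≤ G F clZ
    small : ∀ xs → Enumerates Z xs → ⊥
    small [] E with ∈⇒∈ˡ E z∈Z
    ... | ()
    small (a ∷ []) E = <⇒≱ F<k (≤-trans (≤-reflexive (sym (trans (boundary₁ G E) (regular a)))) B≤)
    small (a ∷ b ∷ []) E = small-pair-absurd
      (trans (boundary₂ G E) (cong₂ _+_ (regular a) (regular b))) B≤ (double-e≤2 G a b) F<k 4≤k
    small (_ ∷ _ ∷ _ ∷ _) E with subst (_≤ 2) (∣p∣≡length E) Z≤2
    ... | s≤s (s≤s ())

  -- The edges `uv` and `wu` share the end `u`, so minimality compares their other ends.
  min-edge-degree : ∀ {u v w} → MinEdge H u v → Adj H w u → deg H v ≤ deg H w
  min-edge-degree (uv , min) wu = compare-degrees (edge-boundary H uv) (edge-boundary H wu) (min _ _ wu)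

  -- A vertex isolated by the cut around a minimum edge uv has all its
  -- neighbours in {u, v}; minimality then makes two vertices of low degree.
  min-edge-cut : 4 ≤ k → size F < k → ∀ {u v} → MinEdge H u v → ClosedCut 1 H (cut H (pair u v))
  min-edge-cut 4≤k F<k {u} {v} me@(uv , min) =
    cut⊆ H X , (X , (u , u∈X) , cut-closed H X , outside) , large
    where
    X = pair u v
    E = pair-enum (Adj-irr H uv)
    u∈X : u ∈ X
    u∈X = ∈ˡ⇒∈ E (here refl)
    v∈X : v ∈ X
    v∈X = ∈ˡ⇒∈ E (there (here refl))
    outside : ∃[ w ] w ∉ X
    outside = let w , _ , w∉ = ∃-neighbour∉ G u (u ∷ v ∷ [])
                    (≤-trans (<⇒≤ 4≤k) (≤-reflexive (sym (regular u))))
              in w , λ w∈X → w∉ (∈⇒∈ˡ E w∈X)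
    flipped : MinEdge H v u
    flipped = Adj-sym H uv , λ x y xy → ≤-trans (≤-reflexive (+-cancelʳ-≡ 2 _ _
      (trans (edge-boundary H (Adj-sym H uv)) (trans (+-comm (deg H v) _) (sym (edge-boundary H uv))))))
      (min x y xy)
    -- `w` is a vertex of degree 1 attached to one end of the minimum edge, and `x` is the other
    -- end; minimality forces `x` to have degree at most 1 as well.
    leaf : ∀ {x w} → x ≢ w → deg H x ≤ deg H w → deg H w ≤ 1 → ⊥
    leaf {x} {w} x≢w dx≤ dw≤1 = low-degrees-absurd {d₁ = deg H x} {deg H w} F<k 4≤k (degree₂ x≢w)
      (+-mono-≤ (+-mono-≤ (≤-trans dx≤ dw≤1) dw≤1) (double-e≤2 F x w))
    isolated : ∀ {w} → w ∉ X → deg H w ≡ e H w u + (e H w v + 0) → ⊥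
    isolated {w} w∉X dw≡ with T? (adj H w u) | T? (adj H w v)
    -- Both `u` and `v` have degree at most that of `w`, which is 2, and the edge `uv` survives in
    -- `H`, so that no edge of `F` is counted twice.
    ... | yes wu | yes wv = low-degrees-absurd {d₁ = deg H u} {deg H v} F<k 4≤k (degree₂ (Adj-irr H uv))
            (subst (λ t → deg H u + deg H v + 2 * t ≤ 4) (sym (ι≡0 (H⇒¬F uv)))
              (≤-trans (≤-reflexive (+-identityʳ _))
                (+-mono-≤ (≤-trans (min-edge-degree flipped wv) dw≤2) (≤-trans (min-edge-degree me wu) dw≤2))))
      where
      dw≤2 : deg H w ≤ 2
      dw≤2 = ≤-reflexive (trans dw≡ (cong₂ (λ p q → p + (q + 0)) (ι≡1 wu) (ι≡1 wv)))
    ... | yes wu | no ¬wv = leaf (λ { refl → w∉X v∈X }) (min-edge-degree me wu)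
            (≤-reflexive (trans dw≡ (cong₂ (λ p q → p + (q + 0)) (ι≡1 wu) (ι≡0 ¬wv))))
    ... | no ¬wu | yes wv = leaf (λ { refl → w∉X u∈X }) (min-edge-degree flipped wv)
            (≤-reflexive (trans dw≡ (cong₂ (λ p q → p + (q + 0)) (ι≡0 ¬wu) (ι≡1 wv))))
    ... | no ¬wu | no ¬wv = <⇒≱ F<k (subst (λ d → k ≤ d + size F)
            (trans dw≡ (cong₂ (λ p q → p + (q + 0)) (ι≡0 ¬wu) (ι≡0 ¬wv))) (degree₁ w))
    uncut-inside : ∀ {x y} → x ∈ X → y ∈ X → ¬ Adj (cut H X) x y
    uncut-inside x∈X y∈X c with cut⁻ H X c
    ... | _ , inj₁ (_ , y∉X) = y∉X y∈X
    ... | _ , inj₂ (_ , x∉X) = x∉X x∈X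
    uncut-outside : ∀ {x y} → x ∉ X → y ∉ X → ¬ Adj (cut H X) x y
    uncut-outside x∉X y∉X c with cut⁻ H X c
    ... | _ , inj₁ (x∈X , _) = x∉X x∈X
    ... | _ , inj₂ (y∈X , _) = y∉X y∈X
    singleton-absurd : ∀ {Y w} → Closed (H ∖ cut H X) Y → Enumerates Y (w ∷ []) → ⊥
    singleton-absurd {Y} {w} cl EY with w ∈? X
    ... | yes w∈X with ∈⇒∈ˡ E w∈X
    ...   | here refl with ∈⇒∈ˡ EY (cl (∈ˡ⇒∈ EY (here refl)) (∖⁺ H (cut H X) uv (uncut-inside u∈X v∈X)))
    ...     | here refl = Adj-irr H uv refl
    singleton-absurd {Y} {w} cl EY | yes w∈X | there (here refl)
      with ∈⇒∈ˡ EY (cl (∈ˡ⇒∈ EY (here refl)) (∖⁺ H (cut H X) (Adj-sym H uv) (uncut-inside v∈X u∈X)))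
    ...     | here refl = Adj-irr H uv refl
    singleton-absurd {Y} {w} cl EY | no w∉X = isolated w∉X (deg-within H E within)
      where
      within : ∀ {x} → Adj H w x → x ∈ X
      within {x} wx with x ∈? X
      ... | yes x∈X = x∈X
      ... | no x∉X with ∈⇒∈ˡ EY (cl (∈ˡ⇒∈ EY (here refl)) (∖⁺ H (cut H X) wx (uncut-outside w∉X x∉X)))
      ...   | here refl = ⊥-elim (Adj-irr H wx refl)
    large : ∀ Y → Nonempty Y → Closed (H ∖ cut H X) Y → 1 < ∣ Y ∣
    large Y (y , y∈Y) cl = go (proj₁ (elements Y)) (proj₂ (elements Y))
      where
      go : ∀ xs → Enumerates Y xs → 1 < ∣ Y ∣
      go [] EY with ∈⇒∈ˡ EY y∈Y
      ... | ()
      go (w ∷ []) EY = ⊥-elim (singleton-absurd cl EY)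
      go (_ ∷ _ ∷ _) EY = ≤-trans (s≤s (s≤s z≤n)) (≤-reflexive (sym (∣p∣≡length EY)))

ι-sum≤2 : ∀ {x y z} → ¬ (T x × T y × T z) → ι x + ι y + ι z ≤ 2
ι-sum≤2 {false} {false} {z}     _ = ≤-trans (ι≤1 z) (s≤s z≤n)
ι-sum≤2 {false} {true}  {z}     _ = s≤s (ι≤1 z)
ι-sum≤2 {true}  {false} {z}     _ = s≤s (ι≤1 z)
ι-sum≤2 {true}  {true}  {false} _ = s≤s (s≤s z≤n)
ι-sum≤2 {true}  {true}  {true}  ¬t = ⊥-elim (¬t _)

regime-4≤k : ∀ {n k m} {G : Graph n} → Regime G k m → 4 ≤ k
regime-4≤k (triangle-free _ _ 4≤k) = 4≤k
regime-4≤k (general _ 5≤k)         = <⇒≤ 5≤k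

regime-m<k : ∀ {n k m} {G : Graph n} → Regime G k m → m < k
regime-m<k {m = m} (triangle-free _ refl _) = ≤-reflexive (+-comm 1 m)
regime-m<k {m = m} (general refl _)         = ≤-trans (≤-reflexive (+-comm 1 m)) (+-monoʳ-≤ m (s≤s z≤n))

regime-1≤m : ∀ {n k m} {G : Graph n} → Regime G k m → 1 ≤ m
regime-1≤m {m = m} (triangle-free _ refl 4≤k) = +-cancelʳ-≤ 1 1 m (≤-trans (s≤s (s≤s z≤n)) 4≤k)
regime-1≤m {m = m} (general refl 5≤k)         = +-cancelʳ-≤ 3 1 m (<⇒≤ 5≤k)

λ″-bound : ∀ {n k m Λ} {G : Graph n} → Regular G k → Isξ 2 G Λ → Regime G k m → k + k + m ≤ Λ + 3
λ″-bound {k = k} {Λ = Λ} {G} regular ((X , ∣X∣≡3 , _ , refl) , _) regime with elements₃ {X = X} ∣X∣≡3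
... | a , b , c , E = bound regime
  where
  degrees : boundary G X + 2 * (e G a b + e G a c + e G b c) ≡ k + k + k
  degrees = trans (boundary₃ G {X} E) (cong₂ _+_ (cong₂ _+_ (regular a) (regular b)) (regular c))
  bound : ∀ {m} → Regime G k m → k + k + m ≤ boundary G X + 3
  bound (triangle-free tf m+1≡k _) =
    λ″-bound₂ {t = e G a b + e G a c + e G b c} degrees (ι-sum≤2 {adj G a b} {adj G a c} λ (ab , ac , bc) → tf ab bc ac) m+1≡k
  bound (general m+3≡k _) =
    λ″-bound₃ {t = e G a b + e G a c + e G b c} degrees
      (+-mono-≤ (+-mono-≤ (ι≤1 (adj G a b)) (ι≤1 (adj G a c))) (ι≤1 (adj G b c))) m+3≡k

ξ-vertex : ∀ {n h m} {G : Graph n} → Isξ h G m → Fin n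
ξ-vertex ((X , ∣X∣≡1+h , _) , _) = go (elements X)
  where
  go : (∃[ xs ] Enumerates X xs) → _
  go ([] , E) with trans (sym ∣X∣≡1+h) (∣p∣≡length E)
  ... | ()
  go (x ∷ _ , _) = x

module Optimal {n k Λ : ℕ} {G : Graph n} (regular : Regular G k) (4≤k : 4 ≤ k)
  (isλ : Isλ 2 G Λ) (isξ : Isξ 2 G Λ) (k≤Λ : k ≤ Λ) where

  module _ {F H : Graph n} (s : Split G F H) (F<k : size F < k) where

    open Degrees regular s

    neighbour : ∀ x → ∃[ y ] Adj H x y
    neighbour x = let y , xy , _ = ∃-neighbour∉ H x [] 0<deg in y , xy
      where
      0<deg : 0 < deg H x
      0<deg = +-cancelʳ-< (size F) 0 (deg H x) (≤-trans F<k (degree₁ x))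

    always-beaten⇒super : (∀ F′ → ClosedCut 2 H F′ → BeatenByEdge H (size F′)) → IsSuperλ 1 H
    always-beaten⇒super beaten =
      let u = ξ-vertex {m = Λ} {G} isξ
          v , uv = neighbour u
          x , y , me = min-edge H uv
      in beaten⇒super {H = H} (connected 4≤k isλ k≤Λ F<k) me (min-edge-cut 4≤k F<k me) beaten

  module _ {m : ℕ} (regime : Regime G k m)
    (sup : ∀ F → IsλCut 2 G F → ∃[ C ] IsComponent (G ∖ F) C × ∣ C ∣ ≡ 3)
    {F H : Graph n} (s : Split G F H) (F≤m : size F ≤ m) where

    open Split s
    open Degrees regular s

    F<k : size F < k
    F<k = ≤-trans (s≤s F≤m) (regime-m<k regime)

    -- If both ends had degree at most 2, then `F` would have taken at least 2k - 4 from their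
    -- degrees, which is at least k.
    end-degrees : ∀ {a b c} → a ≢ c → Adj H a b → Adj H b c → ¬ Adj H a c → 3 ≤ deg H a ⊎ 3 ≤ deg H c
    end-degrees {a} {b} {c} a≢c ab bc ¬ac =
      path-degrees {S = size F} {2 * e F a c} (degree₂ a≢c) (few regime) 4≤k
      where
      few : Regime G k m → size F + 2 * e F a c < k
      -- The ends of a path on three vertices are not adjacent in a triangle-free graph, so `F`
      -- cannot join them.
      few (triangle-free tf m+1≡k _) = subst (λ t → size F + 2 * t < k)
        (sym (ι≡0 (λ ac → tf (H⇒G ab) (H⇒G bc) (F⊆G a c ac))))
        (subst (_< k) (sym (+-identityʳ (size F))) F<k)
      -- Here `ac` may itself have been removed and then counts twice; m = k - 3 leaves room for
      -- this, as |F| + 2 ≤ k - 1.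
      few (general refl _) = ≤-trans (s≤s (+-mono-≤ F≤m (double-e≤2 F a c)))
        (≤-reflexive (sym (+-suc m 2)))

    path-beaten : ∀ {a b c B} → a ≢ c → Adj H a b → Adj H b c → ¬ Adj H a c →
                  B + 2 * 2 ≡ deg H a + deg H b + deg H c → BeatenByEdge H B
    path-beaten {a} {b} {c} {B} a≢c ab bc ¬ac B≡ with end-degrees a≢c ab bc ¬ac
    ... | inj₂ 3≤c = a , b , ab ,
          path-edge {da = deg H a} {deg H b} {deg H c} (edge-boundary H ab) B≡ 3≤c
    ... | inj₁ 3≤a = c , b , Adj-sym H bc ,
          path-edge {da = deg H c} {deg H b} {deg H a} (edge-boundary H (Adj-sym H bc))
            (trans B≡ (reverse (deg H a) (deg H b) (deg H c))) 3≤a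
      where
      reverse : ∀ x y z → x + y + z ≡ z + y + x
      reverse = solve-∀

    triangle-beaten : ∀ {X a b c B} → Enumerates X (a ∷ b ∷ c ∷ []) → Adj H a b → Adj H a c → Adj H b c →
                      B + 2 * 3 ≡ deg H a + deg H b + deg H c → BeatenByEdge H B
    triangle-beaten {a = a} {b} {c} {B} E ab ac bc B≡ = go regime
      where
      swap₂₃ : ∀ x y z → x + y + z ≡ x + z + y
      swap₂₃ = solve-∀
      rotate : ∀ x y z → x + y + z ≡ y + z + x
      rotate = solve-∀
      go : Regime G k m → BeatenByEdge H B
      go (triangle-free tf _ _) = ⊥-elim (tf (H⇒G ab) (H⇒G bc) (H⇒G ac))
      go (general m+3≡k 5≤k) with triangle-degrees {da = deg H a} {deg H b} {deg H c}
          (degree₃ E (H⇒¬F ab) (H⇒¬F ac) (H⇒¬F bc)) F≤m m+3≡k 5≤k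
      ... | inj₁ 5≤a = b , c , bc , triangle-edge {da = deg H b} {deg H c} {deg H a} (edge-boundary H bc)
              (trans B≡ (rotate (deg H a) (deg H b) (deg H c))) 5≤a
      ... | inj₂ (inj₁ 5≤b) = a , c , ac , triangle-edge {da = deg H a} {deg H c} {deg H b} (edge-boundary H ac)
              (trans B≡ (swap₂₃ (deg H a) (deg H b) (deg H c))) 5≤b
      ... | inj₂ (inj₂ 5≤c) = a , b , ab , triangle-edge {da = deg H a} {deg H b} {deg H c} (edge-boundary H ab) B≡ 5≤c

    -- Every vertex of C has a neighbour in C, so C spans a path or a triangle.
    triple-beaten : ∀ {F′ C} → ClosedCut 2 H F′ → Closed (H ∖ F′) C → ∣ C ∣ ≡ 3 → BeatenByEdge H (boundary H C)
    triple-beaten {F′} {C} (_ , _ , large) cl ∣C∣≡3 with elements₃ ∣C∣≡3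
    ... | a , b , c , E with unique E
    ...   | (a≢b ∷ a≢c ∷ []) ∷ (b≢c ∷ []) ∷ [] ∷ [] =
      go (T? (adj H a b)) (T? (adj H a c)) (T? (adj H b c))
      where
      -- A vertex without neighbours in `H ∖ F′` would be a closed set of size 1; otherwise a
      -- neighbour lies in `C` because `C` is closed.
      neighbour-in-C : ∀ {x} → x ∈ C → ∃[ y ] y ∈ C × Adj H x y
      neighbour-in-C {x} x∈C with any? (λ y → T? (adj (H ∖ F′) x y))
      ... | yes (y , xy) = y , cl x∈C xy , proj₁ (∖⁻ H F′ xy)
      ... | no none = ⊥-elim (<⇒≱ (large ⁅ x ⁆ (x , x∈⁅x⁆ x) single)
                        (≤-trans (≤-reflexive (∣⁅x⁆∣≡1 x)) (s≤s z≤n)))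
        where
        single : Closed (H ∖ F′) ⁅ x ⁆
        single {u} {v} u∈ uv with x∈⁅y⁆⇒x≡y x u∈
        ... | refl = ⊥-elim (none (v , uv))
      near : ∀ {x} → x ∈ C → Adj H x a ⊎ Adj H x b ⊎ Adj H x c
      near x∈C with neighbour-in-C x∈C
      ... | y , y∈C , xy with ∈⇒∈ˡ E y∈C
      ...   | here refl                 = inj₁ xy
      ...   | there (here refl)         = inj₂ (inj₁ xy)
      ...   | there (there (here refl)) = inj₂ (inj₂ xy)
      loop : ∀ {x} → ¬ Adj H x x
      loop xx = Adj-irr H xx refl
      degrees : ∀ {x y z} → e H a b ≡ x → e H a c ≡ y → e H b c ≡ z →
                boundary H C + 2 * (x + y + z) ≡ deg H a + deg H b + deg H c
      degrees refl refl refl = boundary₃ H E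
      swap₁₂ : ∀ x y z → x + y + z ≡ y + x + z
      swap₁₂ = solve-∀
      swap₂₃ : ∀ x y z → x + y + z ≡ x + z + y
      swap₂₃ = solve-∀
      go : Dec (Adj H a b) → Dec (Adj H a c) → Dec (Adj H b c) → BeatenByEdge H (boundary H C)
      go (yes ab) (yes ac) (yes bc) = triangle-beaten E ab ac bc (degrees (ι≡1 ab) (ι≡1 ac) (ι≡1 bc))
      go (yes ab) (no ¬ac) (yes bc) = path-beaten a≢c ab bc ¬ac (degrees (ι≡1 ab) (ι≡0 ¬ac) (ι≡1 bc))
      go (yes ab) (yes ac) (no ¬bc) = path-beaten b≢c (Adj-sym H ab) ac ¬bc
        (trans (degrees (ι≡1 ab) (ι≡1 ac) (ι≡0 ¬bc)) (swap₁₂ (deg H a) (deg H b) (deg H c)))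
      go (no ¬ab) (yes ac) (yes bc) = path-beaten a≢b ac (Adj-sym H bc) ¬ab
        (trans (degrees (ι≡0 ¬ab) (ι≡1 ac) (ι≡1 bc)) (swap₂₃ (deg H a) (deg H b) (deg H c)))
      -- Two missing edges share a vertex, which would then have no neighbour in `C`.
      go (no ¬ab) (no ¬ac) _ = ⊥-elim ([ loop , [ ¬ab , ¬ac ]′ ]′ (near (∈ˡ⇒∈ E (here refl))))
      go (no ¬ab) _ (no ¬bc) = ⊥-elim ([ ¬ab ∘ Adj-sym H , [ loop , ¬bc ]′ ]′ (near (∈ˡ⇒∈ E (there (here refl)))))
      go _ (no ¬ac) (no ¬bc) = ⊥-elim ([ ¬ac ∘ Adj-sym H , [ ¬bc ∘ Adj-sym H , loop ]′ ]′
        (near (∈ˡ⇒∈ E (there (there (here refl))))))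

    damaged? : (∃[ x ] ∃[ y ] Adj F x y) ⊎ size F ≡ 0
    damaged? with any? (λ x → any? (λ y → T? (adj F x y)))
    ... | yes xy  = inj₁ xy
    ... | no none = inj₂ (∑-0 {n} λ x → ∑-0 {n} λ y → ι≡0 λ t →
                      none (x , y , proj₂ (to (T-∧ {toℕ x <ᵇ toℕ y}) t)))

    -- The edge is taken at an end of a removed edge, where the degree in `H` is at most k - 1. Such
    -- an edge exists because |F| < k leaves every vertex a neighbour.
    large-beaten : ∀ {s′} → Λ < size F + s′ → BeatenByEdge H s′
    large-beaten Λ< with damaged?
    ... | inj₁ (x , y , xy) = let z , xz = neighbour s F<k x in x , z , xz ,
      damaged-edge {S = size F} {dx = deg H x} {deg F x} {deg H z}
        (edge-boundary H xz) (degree x) (≤-trans (≤-reflexive (sym (ι≡1 xy))) (e≤deg F x y)) (degree≤ z)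
        Λ< F≤m (λ″-bound {G = G} regular isξ regime)
    ... | inj₂ F≡0 = let x = ξ-vertex {m = Λ} {G} isξ ; z , xz = neighbour s F<k x in x , z , xz ,
      undamaged-edge {S = size F} {dx = deg H x} {deg H z}
        (edge-boundary H xz) (degree≤ x) (degree≤ z) Λ< F≡0 (regime-1≤m regime) (λ″-bound {G = G} regular isξ regime)

    regime-beaten : ∀ F′ → ClosedCut 2 H F′ → BeatenByEdge H (size F′)
    regime-beaten F′ c = go (m≤n⇒m<n∨m≡n Λ≤)
      where
      U : EdgeSet n
      U = F ∪E F′
      size-U : size U ≡ size F + size F′
      size-U = closedCut-size {G = G} {F} {H} {F′} s c
      cut-U : IsExtraEdgeCut 2 G U
      cut-U = closedCut⇒cut {G = G} {U} (∪-closedCut {G = G} {F} {H} {F′} s c)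
      Λ≤ : Λ ≤ size U
      Λ≤ = proj₂ isλ (size U) (U , cut-U , refl)
      go : Λ < size U ⊎ Λ ≡ size U → BeatenByEdge H (size F′)
      go (inj₁ Λ<) = large-beaten (subst (Λ <_) size-U Λ<)
      go (inj₂ Λ≡) with sup U (cut-U , subst (Isλ 2 G) Λ≡ isλ)
      ... | C , comp , ∣C∣≡3 = let u , v , uv , bd< = triple-beaten {F′} c cl ∣C∣≡3 in
              u , v , uv , ≤-trans bd< (closed⇒boundary≤ H F′ cl)
        where
        cl : Closed (H ∖ F′) C
        cl = closed-≗ {G = G ∖ U} {H ∖ F′} (λ u v → sym (∪-transfer F′ s u v)) (component-closed (G ∖ U) comp)

    regime-super : IsSuperλ 1 H
    regime-super = always-beaten⇒super s F<k regime-beaten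

-- Decidability of robustness

Robust : ∀ {n} → Graph n → ℕ → Set
Robust G j = ∀ F → F ⊆E G → size F ≤ j → IsSuperλ 1 (G ∖ F)

module _ {n : ℕ} where

  infix 4 _≈_
  _≈_ : Graph n → Graph n → Set
  G ≈ H = ∀ u v → adj G u v ≡ adj H u v

  anyVec? : ∀ {m} {P : Vec (Subset n) m → Set} → (∀ M → Dec (P M)) → Dec (∃[ M ] P M)
  anyVec? {zero}  P? = map′ (λ p → [] , p) (λ { ([] , p) → p }) (P? [])
  anyVec? {suc m} P? = map′ (λ (X , M , p) → X ∷ M , p) (λ { (X ∷ M , p) → X , M , p })
    (anySubset? λ X → anyVec? λ M → P? (X ∷ M))

  -- Symmetrising and clearing the diagonal turns every Boolean matrix into a graph, so a search
  -- over matrices reaches all graphs up to `≈`.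
  fromMatrix : Vec (Subset n) n → Graph n
  fromMatrix M = record
    { adj     = λ u v → (entry u v ∨ entry v u) ∧ not (does (u ≟ v))
    ; adj-sym = λ u v → cong₂ _∧_ (∨-comm (entry u v) (entry v u)) (cong not (≟-sym u v))
    ; adj-irr = λ v → trans (cong (λ b → (entry v v ∨ entry v v) ∧ not b) (dec-true (v ≟ v) refl)) (∧-zeroʳ _)
    }
    where
    entry : Fin n → Fin n → Bool
    entry u v = lookup (lookup M u) v
    ≟-sym : ∀ u v → does (u ≟ v) ≡ does (v ≟ u)
    ≟-sym u v with u ≟ v
    ... | yes refl = sym (dec-true (u ≟ u) refl)
    ... | no u≢v   = sym (dec-false (v ≟ u) (u≢v ∘ sym))

  toMatrix : Graph n → Vec (Subset n) n
  toMatrix G = tabulate λ u → tabulate (adj G u)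

  fromMatrix∘toMatrix : ∀ G → G ≈ fromMatrix (toMatrix G)
  fromMatrix∘toMatrix G u v = sym (trans (cong (_∧ not (does (u ≟ v)))
    (cong₂ _∨_ (entry≡ u v) (trans (entry≡ v u) (adj-sym G v u)))) (off-diagonal u v))
    where
    entry≡ : ∀ u v → lookup (lookup (toMatrix G) u) v ≡ adj G u v
    entry≡ u v = trans (cong (λ X → lookup X v) (lookup∘tabulate (λ u → tabulate (adj G u)) u))
                       (lookup∘tabulate (adj G u) v)
    off-diagonal : ∀ u v → (adj G u v ∨ adj G u v) ∧ not (does (u ≟ v)) ≡ adj G u v
    off-diagonal u v with u ≟ v
    ... | yes refl rewrite adj-irr G u = refl
    ... | no _     = trans (∧-identityʳ _) (∨-idem (adj G u v))

  -- A graph is recovered from its matrix only entry by entry, since it contains functions and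
  -- proofs; hence `P` has to respect `≈`.
  anyGraph? : ∀ {P : Graph n → Set} → (∀ {G H} → G ≈ H → P G → P H) → (∀ G → Dec (P G)) → Dec (∃[ G ] P G)
  anyGraph? {P} resp P? = map′ (λ (M , p) → fromMatrix M , p)
    (λ (G , p) → toMatrix G , resp {G} (fromMatrix∘toMatrix G) p) (anyVec? (P? ∘ fromMatrix))

  ∖-cong : ∀ {G H F F₁ : Graph n} → G ≈ H → F ≈ F₁ → (G ∖ F) ≈ (H ∖ F₁)
  ∖-cong G≈H F≈F₁ u v = cong₂ (λ a b → a ∧ not b) (G≈H u v) (F≈F₁ u v)

  ≈-sym : ∀ {G H : Graph n} → G ≈ H → H ≈ G
  ≈-sym eq u v = sym (eq u v)

  closedCut-cong : ∀ {h} {G H F F₁ : Graph n} → G ≈ H → F ≈ F₁ → ClosedCut h G F → ClosedCut h H F₁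
  closedCut-cong {h} {G} {H} {F} {F₁} G≈H F≈F₁ (F⊆G , (Y , ne , cl , out) , large) =
      (λ u v t → subst T (G≈H u v) (F⊆G u v (subst T (sym (F≈F₁ u v)) t)))
    , (Y , ne , closed-≗ {G = G ∖ F} {H ∖ F₁} rest cl , out)
    , λ Z neZ clZ → large Z neZ (closed-≗ {G = H ∖ F₁} {G ∖ F} (≈-sym {G ∖ F} {H ∖ F₁} rest) clZ)
    where
    rest : (G ∖ F) ≈ (H ∖ F₁)
    rest = ∖-cong {G} {H} {F} {F₁} G≈H F≈F₁

  boundary-cong : ∀ {G H : Graph n} X → G ≈ H → boundary G X ≡ boundary H X
  boundary-cong X G≈H = ∑-cong {n} λ u → ∑-cong {n} λ v →
    cong (λ b → ι (lookup X u ∧ not (lookup X v) ∧ b)) (G≈H u v)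

  ⊆E? : ∀ (F G : Graph n) → Dec (F ⊆E G)
  ⊆E? F G = all? λ u → all? λ v → T? (adj F u v) →-dec T? (adj G u v)

  closedCut₂? : ∀ (G F : Graph n) → Dec (ClosedCut 2 G F)
  closedCut₂? G F = ⊆E? F G
    ×-dec anySubset? (λ Y → nonempty? Y ×-dec closed? (G ∖ F) Y ×-dec any? (λ v → ¬? (v ∈? Y)))
    ×-dec large?
    where
    large? : Dec (∀ Y → Nonempty Y → Closed (G ∖ F) Y → 2 < ∣ Y ∣)
    large? with small-closed? (G ∖ F)
    ... | inj₁ (Y , ne , cl , Y≤2) = no λ large → <⇒≱ (large Y ne cl) Y≤2
    ... | inj₂ large               = yes large

  beaten? : ∀ (H : Graph n) s → Dec (BeatenByEdge H s)
  beaten? H s = any? λ u → any? λ v → T? (adj H u v) ×-dec (boundary H (pair u v) <? s)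

  beaten-cong : ∀ {G H : Graph n} {s} → G ≈ H → BeatenByEdge G s → BeatenByEdge H s
  beaten-cong {G} {H} {s} G≈H (u , v , uv , bd<) =
    u , v , subst T (G≈H u v) uv , subst (_< s) (boundary-cong {G} {H} (pair u v) G≈H) bd<

  Unbeaten : Graph n → EdgeSet n → EdgeSet n → Set
  Unbeaten G F F′ = ClosedCut 2 (G ∖ F) F′ × ¬ BeatenByEdge (G ∖ F) (size F′)

  unbeaten-cong : ∀ {G F F₁ F′ F₁′} → F ≈ F₁ → F′ ≈ F₁′ → Unbeaten G F F′ → Unbeaten G F₁ F₁′
  unbeaten-cong {G} {F} {F₁} {F′} {F₁′} F≈ F′≈ (c , ¬b) =
      closedCut-cong {2} {G ∖ F} {G ∖ F₁} {F′} {F₁′} rest F′≈ c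
    , λ b → ¬b (beaten-cong {G ∖ F₁} {G ∖ F} (≈-sym {G ∖ F} {G ∖ F₁} rest)
                 (subst (BeatenByEdge (G ∖ F₁)) (sym (size-cong F′ F₁′ F′≈)) b))
    where
    rest : (G ∖ F) ≈ (G ∖ F₁)
    rest = ∖-cong {G} {G} {F} {F₁} (λ _ _ → refl) F≈

  -- A positive witness that robustness fails, made only of edge sets, closed sets and edge
  -- boundaries, so that it can be searched for.
  Fragile : Graph n → ℕ → EdgeSet n → Set
  Fragile G j F = F ⊆E G × size F ≤ j × ∃[ F′ ] Unbeaten G F F′

  fragile-cong : ∀ {G j F F₁} → F ≈ F₁ → Fragile G j F → Fragile G j F₁
  fragile-cong {G} {j} {F} {F₁} F≈ (F⊆G , F≤j , F′ , ub) =
      (λ u v t → F⊆G u v (subst T (sym (F≈ u v)) t))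
    , subst (_≤ j) (size-cong F F₁ F≈) F≤j
    , F′ , unbeaten-cong {G} {F} {F₁} {F′} {F′} F≈ (λ _ _ → refl) ub

  fragile? : ∀ G j F → Dec (Fragile G j F)
  fragile? G j F = ⊆E? F G ×-dec (size F ≤? j) ×-dec
    anyGraph? (λ {F′} {F₁′} eq → unbeaten-cong {G} {F} {F} {F′} {F₁′} (λ _ _ → refl) eq)
              (λ F′ → closedCut₂? (G ∖ F) F′ ×-dec ¬? (beaten? (G ∖ F) (size F′)))

  anyFragile? : ∀ G j → Dec (∃[ F ] Fragile G j F)
  anyFragile? G j = anyGraph? (λ {F} {F₁} → fragile-cong {G} {j} {F} {F₁}) (fragile? G j)

  unbeaten⇒¬super : ∀ {G F F′} → Unbeaten G F F′ → ¬ IsSuperλ 1 (G ∖ F)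
  unbeaten⇒¬super {G} {F} {F′} (c , ¬b) sup = ¬b (super⇒beaten {H = G ∖ F} {F′} sup c)

-- The persistence as a bounded maximum

-- The search descends from the strict upper bound `a + d` and stops at `a` at the latest.
maximum : ∀ {P : ℕ → Set} a d → P a → (∀ j → j < a + d → Dec (P j)) → (∀ j → P j → j < a + d) →
          ∃[ ρ ] IsMaximum P ρ × a ≤ ρ
maximum a zero pa _ bound = ⊥-elim (<-irrefl refl (≤-trans (bound a pa) (≤-reflexive (+-identityʳ a))))
maximum {P} a (suc d) pa P? bound with P? (a + d) (≤-reflexive (sym (+-suc a d)))
... | yes p = a + d , (p , λ j pj → ≤-pred (≤-trans (bound j pj) (≤-reflexive (+-suc a d)))) , m≤m+n a d
... | no ¬p = maximum a d pa (λ j j< → P? j (≤-trans j< (≤-trans (n≤1+n _) (≤-reflexive (sym (+-suc a d))))))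
  (λ j pj → ≤∧≢⇒< (≤-pred (≤-trans (bound j pj) (≤-reflexive (+-suc a d)))) (λ { refl → ¬p pj }))

robust⇒<k : ∀ {n k j} {G : Graph n} → Regular G k → 1 ≤ k → Fin n → Robust G j → j < k
robust⇒<k {n} {k} {j} {G} regular 1≤k v robust = ≰⇒> λ k≤j →
  disconnection⇒¬connected (G ∖ star) (( v , ∈ˡ⇒∈ E (here refl)) , cut-closed G X , outside)
    (proj₁ (robust star (cut⊆ G X) (≤-trans (≤-reflexive size-star) k≤j)))
  where
  X : Subset n
  X = ⟦ v ∷ [] ⟧
  E : Enumerates X (v ∷ [])
  E = ⟦⟧-enumerates ([] ∷ [])
  star : EdgeSet n
  star = cut G X
  size-star : size star ≡ k
  size-star = trans (cut-size G X) (trans (boundary₁ G E) (regular v))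
  outside : ∃[ w ] w ∉ X
  outside with ∃-neighbour∉ G v [] (≤-trans 1≤k (≤-reflexive (sym (regular v))))
  ... | w , vw , _ = w , λ w∈X → Adj-irr G vw (sym (only (∈⇒∈ˡ E w∈X)))
    where
    only : w ∈ˡ v ∷ [] → w ≡ v
    only (here refl) = refl

module _ {n k Λ : ℕ} {G : Graph n} (regular : Regular G k) (4≤k : 4 ≤ k)
  (isλ : Isλ 2 G Λ) (isξ : Isξ 2 G Λ) (k≤Λ : k ≤ Λ) where

  open Optimal {G = G} regular 4≤k isλ isξ k≤Λ

  -- A fragile set refutes robustness. If there is none, every 2-extra edge-cut is beaten, and this
  -- suffices for super-λ′ as long as fewer than k edges are removed.
  robust? : ∀ j → j < k → Dec (Robust G j)
  robust? j j<k with anyFragile? G j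
  ... | yes (F , F⊆G , F≤j , F′ , ub) =
    no λ robust → unbeaten⇒¬super {G = G} {F} {F′} ub (robust F F⊆G F≤j)
  ... | no none = yes λ F F⊆G F≤j → always-beaten⇒super (∖-split G F F⊆G) (≤-trans (s≤s F≤j) j<k)
    λ F′ c → decidable-stable (beaten? (G ∖ F) (size F′)) λ ¬b → none (F , F⊆G , F≤j , F′ , c , ¬b)

-- The case k = 5

_∈ₚ?_ : ∀ {n} (uv : Fin n × Fin n) ps → Dec (uv ∈ˡ ps)
_∈ₚ?_ = DecPropositional._∈?_ (≡-dec _≟_ _≟_)

-- Intersecting the list with the adjacency of `G` supplies irreflexivity and containment in `G`;
-- `flip` says that the list contains both orientations of each pair.
select : ∀ {n} (G : Graph n) (ps : List (Fin n × Fin n)) →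
         (∀ {u v} → (u , v) ∈ˡ ps → (v , u) ∈ˡ ps) → EdgeSet n
select G ps flip = record
  { adj     = λ u v → adj G u v ∧ does ((u , v) ∈ₚ? ps)
  ; adj-sym = λ u v → cong₂ _∧_ (adj-sym G u v) (does-⇔ (mk⇔ flip flip) ((u , v) ∈ₚ? ps) ((v , u) ∈ₚ? ps))
  ; adj-irr = λ v → cong (_∧ does ((v , v) ∈ₚ? ps)) (adj-irr G v)
  }

module _ {n : ℕ} (G : Graph n) (ps : List (Fin n × Fin n)) (flip : ∀ {u v} → (u , v) ∈ˡ ps → (v , u) ∈ˡ ps) where

  private
    F = select G ps flip

  select⁻ : ∀ {u v} → Adj F u v → Adj G u v × (u , v) ∈ˡ ps
  select⁻ {u} {v} t with (u , v) ∈ₚ? ps | to (T-∧ {adj G u v}) t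
  ... | yes uv∈ | uv , _ = uv , uv∈

  select⁺ : ∀ {u v} → Adj G u v → (u , v) ∈ˡ ps → Adj F u v
  select⁺ {u} {v} uv uv∈ = from T-∧ (uv , from T-≡ (dec-true ((u , v) ∈ₚ? ps) uv∈))

  select-degree : ∀ u → deg F u ≤ occurrences (map proj₁ ps) u
  select-degree u = ≤-trans (∑-mono cell) (≤-reflexive (∑-weight ps))
    where
    -- `weight qs v` is the number of occurrences of the pair `(u , v)` in `qs`.
    weight : List (Fin n × Fin n) → Fin n → ℕ
    weight []             v = 0
    weight ((x , y) ∷ qs) v = (if does (y ≟ v) then δ x u else 0) + weight qs v
    ∑-weight : ∀ qs → ∑ (weight qs) ≡ occurrences (map proj₁ qs) u
    ∑-weight []             = ∑-0 {n} λ _ → refl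
    ∑-weight ((x , y) ∷ qs) = trans (∑-+ {n} (λ v → if does (y ≟ v) then δ x u else 0) (weight qs))
      (cong₂ _+_ (∑-if y (λ _ → δ x u)) (∑-weight qs))
    weight≥1 : ∀ {qs v} → (u , v) ∈ˡ qs → 1 ≤ weight qs v
    weight≥1 {(x , y) ∷ qs} {v} (here refl) rewrite dec-true (v ≟ v) refl | δ-refl u = s≤s z≤n
    weight≥1 {(x , y) ∷ qs} {v} (there p)   = ≤-trans (weight≥1 p) (m≤n+m _ _)
    cell : ∀ v → e F u v ≤ weight ps v
    cell v = ι-≤ (λ t → weight≥1 (proj₂ (select⁻ t)))

  2*select-size : 2 * size F ≤ length ps
  2*select-size = ≤-trans (≤-reflexive (size-double F)) (≤-trans (∑-mono select-degree)
    (≤-reflexive (trans (∑-occurrences (map proj₁ ps)) (length-map proj₁ ps))))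

-- Deleting a matching of three edges between a triangle and its complement
-- leaves the triangle with boundary 6, and no edge with less.
module Matching {n : ℕ} {G : Graph n} (regular : Regular G 5) {a b c : Fin n}
  (ab : Adj G a b) (bc : Adj G b c) (ac : Adj G a c) where

  C : Subset n
  C = ⟦ a ∷ b ∷ c ∷ [] ⟧

  E : Enumerates C (a ∷ b ∷ c ∷ [])
  E = ⟦⟧-enumerates ((Adj-irr G ab ∷ Adj-irr G ac ∷ []) ∷ (Adj-irr G bc ∷ []) ∷ [] ∷ [])

  a∈C : a ∈ C
  a∈C = ∈ˡ⇒∈ E (here refl)

  b∈C : b ∈ C
  b∈C = ∈ˡ⇒∈ E (there (here refl))

  c∈C : c ∈ C
  c∈C = ∈ˡ⇒∈ E (there (there (here refl)))

  avoiding : ∀ x xs → length xs ≤ 4 → ∃[ y ] Adj G x y × y ∉ˡ xs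
  avoiding x xs len = ∃-neighbour∉ G x xs (≤-trans (s≤s len) (≤-reflexive (sym (regular x))))

  record Mate (x : Fin n) (xs : List (Fin n)) : Set where
    field
      mate     : Fin n
      adjacent : Adj G x mate
      outside  : mate ∉ C
      fresh    : mate ∉ˡ xs

  -- Of the five neighbours of `x`, two are the other vertices of the triangle and at most two are
  -- forbidden by `xs`, so one remains.
  mateOf : ∀ x xs → length xs ≤ 2 → x ∈ C → Mate x xs
  mateOf x xs len x∈C with ∈⇒∈ˡ E x∈C
  ... | here refl = let y , xy , y∉ = avoiding a (b ∷ c ∷ xs) (s≤s (s≤s len)) in record
    { mate = y ; adjacent = xy ; fresh = y∉ ∘ there ∘ there
    ; outside = λ y∈C → out xy y∉ (∈⇒∈ˡ E y∈C) }
    where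
    out : ∀ {y} → Adj G a y → y ∉ˡ b ∷ c ∷ xs → y ∉ˡ a ∷ b ∷ c ∷ []
    out ay y∉ (here refl)                 = Adj-irr G ay refl
    out ay y∉ (there (here refl))         = y∉ (here refl)
    out ay y∉ (there (there (here refl))) = y∉ (there (here refl))
  ... | there (here refl) = let y , xy , y∉ = avoiding b (a ∷ c ∷ xs) (s≤s (s≤s len)) in record
    { mate = y ; adjacent = xy ; fresh = y∉ ∘ there ∘ there
    ; outside = λ y∈C → out xy y∉ (∈⇒∈ˡ E y∈C) }
    where
    out : ∀ {y} → Adj G b y → y ∉ˡ a ∷ c ∷ xs → y ∉ˡ a ∷ b ∷ c ∷ []
    out by y∉ (here refl)                 = y∉ (here refl)
    out by y∉ (there (here refl))         = Adj-irr G by refl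
    out by y∉ (there (there (here refl))) = y∉ (there (here refl))
  ... | there (there (here refl)) = let y , xy , y∉ = avoiding c (a ∷ b ∷ xs) (s≤s (s≤s len)) in record
    { mate = y ; adjacent = xy ; fresh = y∉ ∘ there ∘ there
    ; outside = λ y∈C → out xy y∉ (∈⇒∈ˡ E y∈C) }
    where
    out : ∀ {y} → Adj G c y → y ∉ˡ a ∷ b ∷ xs → y ∉ˡ a ∷ b ∷ c ∷ []
    out cy y∉ (here refl)                 = y∉ (here refl)
    out cy y∉ (there (here refl))         = y∉ (there (here refl))
    out cy y∉ (there (there (here refl))) = Adj-irr G cy refl

  mateA : Mate a []
  mateA = mateOf a [] z≤n a∈C
  open Mate mateA using () renaming (mate to a′; adjacent to aa′; outside to a′∉C)

  mateB : Mate b (a′ ∷ [])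
  mateB = mateOf b (a′ ∷ []) (s≤s z≤n) b∈C
  open Mate mateB using () renaming (mate to b′; adjacent to bb′; outside to b′∉C; fresh to b′-fresh)

  mateC : Mate c (a′ ∷ b′ ∷ [])
  mateC = mateOf c (a′ ∷ b′ ∷ []) ≤-refl c∈C
  open Mate mateC using () renaming (mate to c′; adjacent to cc′; outside to c′∉C; fresh to c′-fresh)

  ps : List (Fin n × Fin n)
  ps = (a , a′) ∷ (b , b′) ∷ (c , c′) ∷ (a′ , a) ∷ (b′ , b) ∷ (c′ , c) ∷ []

  ps-flip : ∀ {u v} → (u , v) ∈ˡ ps → (v , u) ∈ˡ ps
  ps-flip (here refl)                                         = there (there (there (here refl)))
  ps-flip (there (here refl))                                 = there (there (there (there (here refl))))
  ps-flip (there (there (here refl)))                         = there (there (there (there (there (here refl)))))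
  ps-flip (there (there (there (here refl))))                 = here refl
  ps-flip (there (there (there (there (here refl)))))         = there (here refl)
  ps-flip (there (there (there (there (there (here refl)))))) = there (there (here refl))

  F : EdgeSet n
  F = select G ps ps-flip

  F-crosses : ∀ {u v} → Adj F u v → (u ∈ C × v ∉ C) ⊎ (v ∈ C × u ∉ C)
  F-crosses uv with proj₂ (select⁻ G ps ps-flip uv)
  ... | here refl                                         = inj₁ (a∈C , a′∉C)
  ... | there (here refl)                                 = inj₁ (b∈C , b′∉C)
  ... | there (there (here refl))                         = inj₁ (c∈C , c′∉C)
  ... | there (there (there (here refl)))                 = inj₂ (a∈C , a′∉C)
  ... | there (there (there (there (here refl))))         = inj₂ (b∈C , b′∉C)
  ... | there (there (there (there (there (here refl))))) = inj₂ (c∈C , c′∉C)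

  F⊆G : F ⊆E G
  F⊆G u v uv = proj₁ (select⁻ G ps ps-flip uv)

  size-F : size F ≤ 3
  size-F = *-cancelˡ-≤ {size F} {3} 2 (2*select-size G ps ps-flip)

  -- This makes `F` a matching: no vertex loses more than one edge, so all degrees in `H` are at
  -- least 4.
  ends-unique : Unique (map proj₁ ps)
  ends-unique =
      (Adj-irr G ab ∷ Adj-irr G ac ∷ apart a∈C a′∉C ∷ apart a∈C b′∉C ∷ apart a∈C c′∉C ∷ [])
    ∷ (Adj-irr G bc ∷ apart b∈C a′∉C ∷ apart b∈C b′∉C ∷ apart b∈C c′∉C ∷ [])
    ∷ (apart c∈C a′∉C ∷ apart c∈C b′∉C ∷ apart c∈C c′∉C ∷ [])
    ∷ ((λ a′≡b′ → b′-fresh (here (sym a′≡b′))) ∷ (λ a′≡c′ → c′-fresh (here (sym a′≡c′))) ∷ [])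
    ∷ ((λ b′≡c′ → c′-fresh (there (here (sym b′≡c′)))) ∷ [])
    ∷ [] ∷ []
    where
    apart : ∀ {x y} → x ∈ C → y ∉ C → x ≢ y
    apart x∈C y∉C refl = y∉C x∈C

  degree-F≤1 : ∀ u → deg F u ≤ 1
  degree-F≤1 u = ≤-trans (select-degree G ps ps-flip u) (unique⇒occurrences ends-unique u)

  H : Graph n
  H = G ∖ F

  open Degrees {G = G} {F} {H} regular (∖-split G F F⊆G)

  same-side : ∀ {x y} → Adj G x y → (x ∈ C → y ∈ C) → (y ∈ C → x ∈ C) → Adj (H ∖ cut H C) x y
  same-side xy x⇒y y⇒x = ∖⁺ H (cut H C) (∖⁺ G F xy (crosses ∘ F-crosses)) (crosses ∘ proj₂ ∘ cut⁻ H C)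
    where
    crosses : ¬ ((_ ∈ C × _ ∉ C) ⊎ (_ ∈ C × _ ∉ C))
    crosses (inj₁ (x∈C , y∉C)) = y∉C (x⇒y x∈C)
    crosses (inj₂ (y∈C , x∉C)) = x∉C (y⇒x y∈C)

  inside-edge : ∀ {x y} → Adj G x y → x ∈ C → y ∈ C → Adj (H ∖ cut H C) x y
  inside-edge xy x∈C y∈C = same-side xy (λ _ → y∈C) (λ _ → x∈C)

  outside-edge : ∀ {x y} → Adj G x y → x ∉ C → y ∉ C → Adj (H ∖ cut H C) x y
  outside-edge xy x∉C y∉C = same-side xy (⊥-elim ∘ x∉C) (⊥-elim ∘ y∉C)

  degree-matched : ∀ {x y} → Adj F x y → deg H x ≤ 4
  degree-matched {x} {y} xy = +-cancelʳ-≤ 1 (deg H x) 4 (≤-trans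
    (+-monoʳ-≤ (deg H x) (≤-trans (≤-reflexive (sym (ι≡1 xy))) (e≤deg F x y)))
    (≤-reflexive (degree x)))

  degree-H≥4 : ∀ x → 4 ≤ deg H x
  degree-H≥4 x = +-cancelʳ-≤ 1 4 (deg H x) (≤-trans (≤-reflexive (sym (degree x)))
    (+-monoʳ-≤ (deg H x) (degree-F≤1 x)))

  -- Three degrees of at most 4, less twice the three edges of the triangle: 12 - 6.
  boundary-C : boundary H C ≤ 6
  boundary-C = +-cancelʳ-≤ 6 (boundary H C) 6 (≤-trans (≤-reflexive (trans
      (cong (λ t → boundary H C + 2 * t) (sym (cong₂ _+_ (cong₂ _+_ (ι≡1 (edge ab a∈C b∈C))
        (ι≡1 (edge ac a∈C c∈C))) (ι≡1 (edge bc b∈C c∈C)))))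
      (boundary₃ H E)))
    (+-mono-≤ (+-mono-≤ (degree-matched {a} {a′} (select⁺ G ps ps-flip aa′ (here refl)))
                        (degree-matched {b} {b′} (select⁺ G ps ps-flip bb′ (there (here refl)))))
              (degree-matched {c} {c′} (select⁺ G ps ps-flip cc′ (there (there (here refl)))))))
    where
    edge : ∀ {x y} → Adj G x y → x ∈ C → y ∈ C → Adj H x y
    edge xy x∈C y∈C = proj₁ (∖⁻ H (cut H C) (inside-edge xy x∈C y∈C))

  -- Two degrees of at least 4, less twice the edge itself: 8 - 2.
  edge-boundary≥6 : ∀ {u v} → Adj H u v → 6 ≤ boundary H (pair u v)
  edge-boundary≥6 {u} {v} uv = +-cancelʳ-≤ 2 6 (boundary H (pair u v))
    (≤-trans (+-mono-≤ (degree-H≥4 u) (degree-H≥4 v)) (≤-reflexive (sym (edge-boundary H uv))))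

  unbeaten : Unbeaten G F (cut H C)
  unbeaten = (cut⊆ H C , (C , (a , a∈C) , cut-closed H C , a′ , a′∉C) , large) , λ (u , v , uv , bd<) →
    <⇒≱ bd< (≤-trans (≤-reflexive (cut-size H C)) (≤-trans boundary-C (edge-boundary≥6 uv)))
    where
    large : ∀ Y → Nonempty Y → Closed (H ∖ cut H C) Y → 2 < ∣ Y ∣
    large Y (y , y∈Y) cl with y ∈? C
    ... | yes y∈C = length≤∣p∣ (unique E) λ x∈ → join (∈⇒∈ˡ E y∈C) (∈⇒∈ˡ E (∈ˡ⇒∈ E x∈))
      where
      join : ∀ {x} → y ∈ˡ a ∷ b ∷ c ∷ [] → x ∈ˡ a ∷ b ∷ c ∷ [] → x ∈ Y
      join {x} y∈ x∈ with x ≟ y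
      ... | yes refl = y∈Y
      ... | no x≢y   = cl y∈Y (inside-edge (adjacent y∈ x∈) y∈C (∈ˡ⇒∈ E x∈))
        where
        adjacent : y ∈ˡ a ∷ b ∷ c ∷ [] → x ∈ˡ a ∷ b ∷ c ∷ [] → Adj G y x
        adjacent (here refl)                 (here refl)                 = ⊥-elim (x≢y refl)
        adjacent (here refl)                 (there (here refl))         = ab
        adjacent (here refl)                 (there (there (here refl))) = ac
        adjacent (there (here refl))         (here refl)                 = Adj-sym G ab
        adjacent (there (here refl))         (there (here refl))         = ⊥-elim (x≢y refl)
        adjacent (there (here refl))         (there (there (here refl))) = bc
        adjacent (there (there (here refl))) (here refl)                 = Adj-sym G ac
        adjacent (there (there (here refl))) (there (here refl))         = Adj-sym G bc
        adjacent (there (there (here refl))) (there (there (here refl))) = ⊥-elim (x≢y refl)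
    -- Outside the triangle `y` keeps its edges to other outside vertices. At most three of its five
    -- neighbours lie in `C`, so two remain, and with `y` they make three vertices of `Y`.
    ... | no y∉C with avoiding y (a ∷ b ∷ c ∷ []) (s≤s (s≤s (s≤s z≤n)))
    ...   | x , yx , x∉ with avoiding y (x ∷ a ∷ b ∷ c ∷ []) ≤-refl
    ...     | z , yz , z∉ = length≤∣p∣ {X = Y} {y ∷ x ∷ z ∷ []}
      ((Adj-irr G yx ∷ Adj-irr G yz ∷ []) ∷ ((λ x≡z → z∉ (here (sym x≡z))) ∷ []) ∷ [] ∷ [])
      λ { (here refl)                 → y∈Y
        ; (there (here refl))         → cl y∈Y (outside-edge yx y∉C (x∉ ∘ ∈⇒∈ˡ E))
        ; (there (there (here refl))) → cl y∈Y (outside-edge yz y∉C (z∉ ∘ there ∘ ∈⇒∈ˡ E)) }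

  robust⇒≤2 : ∀ j → Robust G j → j ≤ 2
  robust⇒≤2 j robust = ≮⇒≥ λ 2<j →
    unbeaten⇒¬super {G = G} {F} {cut H C} unbeaten (robust F F⊆G (≤-trans size-F 2<j))

-- Girth and triangles, and the three assertions

triangle⇒cycle : ∀ {n} {G : Graph n} {a b c} → Adj G a b → Adj G b c → Adj G a c → Cycle G 3
triangle⇒cycle {n} {G} {a} {b} {c} ab bc ac = record
  { length≥3 = ≤-refl ; vertex = vertex ; injective = λ {i} {j} → injective i j ; step = step ; close = close }
  where
  vertex : Fin 3 → Fin n
  vertex zero             = a
  vertex (suc zero)       = b
  vertex (suc (suc zero)) = c
  injective : ∀ i j → vertex i ≡ vertex j → i ≡ j
  injective zero             zero             _  = refl
  injective zero             (suc zero)       eq = ⊥-elim (Adj-irr G ab eq)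
  injective zero             (suc (suc zero)) eq = ⊥-elim (Adj-irr G ac eq)
  injective (suc zero)       zero             eq = ⊥-elim (Adj-irr G ab (sym eq))
  injective (suc zero)       (suc zero)       _  = refl
  injective (suc zero)       (suc (suc zero)) eq = ⊥-elim (Adj-irr G bc eq)
  injective (suc (suc zero)) zero             eq = ⊥-elim (Adj-irr G ac (sym eq))
  injective (suc (suc zero)) (suc zero)       eq = ⊥-elim (Adj-irr G bc (sym eq))
  injective (suc (suc zero)) (suc (suc zero)) _  = refl
  step : ∀ i j → toℕ j ≡ suc (toℕ i) → Adj G (vertex i) (vertex j)
  step zero       (suc zero)       _ = ab
  step (suc zero) (suc (suc zero)) _ = bc
  close : ∀ i j → suc (toℕ i) ≡ 3 → toℕ j ≡ 0 → Adj G (vertex i) (vertex j)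
  close (suc (suc zero)) zero _ _ = Adj-sym G ac

theorem3p8 : (n k : ℕ) (G : Graph n) → 4 ≤ k → Regular G k → IsSuperλ 2 G →
    (g : ℕ) → IsGirth G g →
    (4 ≤ g → IsPersistence G (k ∸ 1))
    × (g ≡ 3 → (6 ≤ k → ∃[ ρ ] IsPersistence G ρ × k ∸ 3 ≤ ρ)
    × (k ≡ 5 → IsPersistence G 2))
theorem3p8 n k G 4≤k regular (_ , (Λ , isλ , isξ) , sup) g (cycle , shortest) =
  part-i , λ g≡3 → part-ii , part-iii g≡3
  where
  1≤k : 1 ≤ k
  1≤k = ≤-trans (s≤s z≤n) 4≤k

  module _ {m} (regime : Regime G k m) where

    k≤Λ : k ≤ Λ
    k≤Λ = k≤λ″ {m = m} (λ″-bound {G = G} regular isξ regime) 4≤k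

    open Optimal {G = G} regular 4≤k isλ isξ k≤Λ

    super-λ′ : IsSuperλ 1 G
    super-λ′ = regime-super regime sup (∅-split G) (≤-trans (≤-reflexive (size-∅ {n})) z≤n)

    robust : Robust G m
    robust F F⊆G F≤m = regime-super regime sup (∖-split G F F⊆G) F≤m

    decide : ∀ j → j < k → Dec (Robust G j)
    decide = robust? {G = G} regular 4≤k isλ isξ k≤Λ

  bound : ∀ j → Robust G j → j < k
  bound j = robust⇒<k {G = G} regular 1≤k (ξ-vertex {m = Λ} {G} isξ)

  part-i : 4 ≤ g → IsPersistence G (k ∸ 1)
  part-i 4≤g = super-λ′ regime , robust regime , λ j rj → ≤-pred (≤-trans (bound j rj) (≤-reflexive k≡))
    where
    k≡ : k ≡ suc (k ∸ 1)
    k≡ = trans (sym (m∸n+n≡m 1≤k)) (+-comm (k ∸ 1) 1)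
    regime : Regime G k (k ∸ 1)
    regime = triangle-free
      (λ ab bc ac → <⇒≱ 4≤g (shortest 3 (triangle⇒cycle {G = G} ab bc ac)))
      (m∸n+n≡m 1≤k) 4≤k

  part-ii : 6 ≤ k → ∃[ ρ ] IsPersistence G ρ × k ∸ 3 ≤ ρ
  -- The candidates are k - 3, k - 2 and k - 1: the first is known to be robust, and k is already
  -- excluded.
  part-ii 6≤k = let ρ , max , k∸3≤ρ = maximum (k ∸ 3) 3 (robust regime)
                      (λ j j< → decide regime j (≤-trans j< (≤-reflexive k≡)))
                      (λ j rj → ≤-trans (bound j rj) (≤-reflexive (sym k≡)))
                in ρ , (super-λ′ regime , max) , k∸3≤ρ
    where
    k≡ : k ∸ 3 + 3 ≡ k
    k≡ = m∸n+n≡m (≤-trans (s≤s (s≤s (s≤s z≤n))) 4≤k)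
    regime : Regime G k (k ∸ 3)
    regime = general k≡ (<⇒≤ 6≤k)

  part-iii : g ≡ 3 → k ≡ 5 → IsPersistence G 2
  part-iii refl refl = super-λ′ regime , robust regime ,
    Matching.robust⇒≤2 {G = G} regular (step zero (suc zero) refl) (step (suc zero) (suc (suc zero)) refl)
      (Adj-sym G (close (suc (suc zero)) zero refl refl))
    where
    open Cycle cycle
    regime : Regime G 5 2
    regime = general refl ≤-refl
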